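{- For every formula $\varphi$ of least fixed-point logic $\mathrm{LFP}$ there exists a first-order interpretation $J_\varphi$ such that the formula $\mathcal Q_{\mathrm{Horn\text{ - }Res}}(J_\varphi)$ is equivalent to $\varphi$ on finite structures. In particular, each $\mathrm{LFP}$-formula can be translated into an equivalent $\mathrm{FO}(\mathrm{Horn\text{ - }Res})$-formula with a single application of the generalised quantifier $\mathcal Q_{\mathrm{Horn\text{ - }Res}}$.
   Context: All structures are finite and relational. A propositional CNF-formula $\psi$ is encoded as a structure over the vocabulary $\{C,V,P,N\}$ whose universe consists of the clauses and variables of $\psi$, where the unary predicates $C,V$ identify clauses and variables, and $Pvc$ (respectively $Nvc$) holds iff variable $v$ occurs positively (respectively negatively) in clause $c$. $\mathrm{Horn\text{ - }Res}$ denotes the class of structures encoding propositional Horn formulas (each clause has at most one positive literal) from which the empty clause can be derived by resolution restricted to Horn clauses. Interpretations: for vocabularies $\sigma$ and $\tau=\{S_1,\dots,S_\ell\}$ and a logic $L$, a $d$-dimensional $L[\sigma,\tau]$-interpretation with parameters $\vec z$ is a tuple $I(\vec z)=(\varphi_\delta,\varphi_\approx,\varphi_{S_1},\dots,\varphi_{S_\ell})$ of $L[\sigma]$-formulas with free variables $\vec z$ plus one $d$-tuple of variables for $\varphi_\delta$, two for $\varphi_\approx$, and $\mathrm{arity}(S_i)$ many for $\varphi_{S_i}$. Given a $\sigma$-structure $\mathfrak A$ and values $\vec a$ for $\vec z$, let $\mathfrak B$ be the structure with universe $\{\vec b\in A^d : \mathfrak A\models\varphi_\delta(\vec b,\vec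 a)\}$ and relations $S_i$ defined by $\varphi_{S_i}$; if $\varphi_\approx$ defines a congruence $\mathcal E$ on $\mathfrak B$, then $I(\mathfrak A,\vec a):=\mathfrak B/\mathcal E$, otherwise $I(\mathfrak A,\vec a)$ is undefined. A first-order interpretation is an $\mathrm{FO}$-interpretation. Lindström quantifier: for a class $\mathcal K$ of $\tau$-structures, $(\mathfrak A,\vec a)\models \mathcal Q_{\mathcal K}I(\vec z)$ iff $I(\mathfrak A,\vec a)$ is defined and belongs to $\mathcal K$. $\mathrm{FO}(\mathrm{Horn\text{ - }Res})$ is the closure of first-order logic under the quantifier $\mathcal Q_{\mathrm{Horn\text{ - }Res}}$ (applied to interpretations formed by formulas of the extended logic). -}

module Defs where

open import Data.Bool.Base using (Bool; T)
open import Data.Empty using (⊥)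
open import Data.Fin.Base using (Fin; zero; suc)
import Data.Fin.Subset as Sub
open import Data.List.Base using (List; []; _∷_; length)
import Data.List.Base as List
open import Data.List.Membership.Propositional using (_∈_)
open import Data.List.Relation.Unary.All using (All)
open import Data.Nat.Base using (ℕ; suc; _+_; _*_; _≤_; NonZero)
open import Data.Product.Base using (Σ-syntax; ∃; _×_; proj₁)
open import Data.Sign.Base using (Sign; opposite) renaming (+ to pos)
open import Data.Sum.Base using (_⊎_; inj₁; inj₂)
open import Data.Unit.Base using (⊤)
open import Data.Vec.Base as Vec using (Vec; []; _∷_; _++_; lookup; map; concat)
open import Data.Vec.Relation.Binary.Pointwise.Inductive using (Pointwise)
open import Function.Base using (_on_)
open import Function.Bundles using (_⇔_; _↔_; Inverse)
open import Relation.Binary.Structures using (IsEquivalence)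
open import Relation.Binary.PropositionalEquality.Core using (_≡_)
open import Relation.Nullary.Negation.Core using (¬_)

------------------------------------------------------------------------
-- Finite relational structures

-- A vocabulary is the list of the arities of its relation symbols.
Vocabulary : Set
Vocabulary = List ℕ

Symbol : Vocabulary → Set
Symbol σ = Fin (length σ)

arity : (σ : Vocabulary) → Symbol σ → ℕ
arity = List.lookup

-- On a finite universe every relation is decidable, hence Bool-valued.
Relation : ℕ → ℕ → Set
Relation n r = Vec (Fin n) r → Bool

-- Universes are non-empty, as usual in finite model theory, and are taken
-- to be initial segments of ℕ, so every finite structure is represented up
-- to isomorphism.
record Structure (σ : Vocabulary) : Set where
  field
    size     : ℕ
    nonEmpty : NonZero size
    rel      : (R : Symbol σ) → Relation size (arity σ R)

  Element : Set
  Element = Fin size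

  holds : (R : Symbol σ) → Vec Element (arity σ R) → Set
  holds R xs = T (rel R xs)

open Structure public

-- The expansion (𝔄 , X) to a vocabulary with one more symbol, `zero`.
_▸_ : ∀ {σ r} (𝔄 : Structure σ) → Relation (size 𝔄) r → Structure (r ∷ σ)
size     (𝔄 ▸ X)         = size 𝔄
nonEmpty (𝔄 ▸ X)         = nonEmpty 𝔄
rel      (𝔄 ▸ X) zero    = X
rel      (𝔄 ▸ X) (suc R) = rel 𝔄 R

------------------------------------------------------------------------
-- Least fixed-point logic

-- LFP σ k consists of the LFP-formulas of vocabulary σ whose free
-- (first-order) variables are among k variables.  The de Bruijn index
-- `zero` is the innermost bound variable.
--
-- `lfp ψ p ts` is [lfp X x₁…xᵣ . ψ](t₁,…,tᵣ): the fixed-point variable X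
-- is the symbol `zero` of the enlarged vocabulary r ∷ σ, the first r of the
-- r + k variables of ψ are x₁,…,xᵣ, and the other k are parameters.

data LFP (σ : Vocabulary) (k : ℕ) : Set

-- SignedIn s X φ: every occurrence of X in φ is positive (s = pos), resp.
-- negative (s = opposite pos): it is under an even, resp. odd, number of negations.
SignedIn : ∀ {σ k} → Sign → Symbol σ → LFP σ k → Set

PositiveIn : ∀ {σ k} → Symbol σ → LFP σ k → Set
PositiveIn = SignedIn pos

infixr 6 _∧′_
infixr 5 _∨′_

data LFP σ k where
  atom      : (R : Symbol σ) → Vec (Fin k) (arity σ R) → LFP σ k
  _≐_       : Fin k → Fin k → LFP σ k
  ¬′_       : LFP σ k → LFP σ k
  _∧′_ _∨′_ : LFP σ k → LFP σ k → LFP σ k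
  ∃′ ∀′     : LFP σ (suc k) → LFP σ k
  lfp       : ∀ {r} (ψ : LFP (r ∷ σ) (r + k)) → PositiveIn zero ψ →
              Vec (Fin k) r → LFP σ k

SignedIn s X (atom R _)  = R ≡ X → s ≡ pos
SignedIn s X (_ ≐ _)     = ⊤
SignedIn s X (¬′ φ)      = SignedIn (opposite s) X φ
SignedIn s X (φ ∧′ ψ)    = SignedIn s X φ × SignedIn s X ψ
SignedIn s X (φ ∨′ ψ)    = SignedIn s X φ × SignedIn s X ψ
SignedIn s X (∃′ φ)      = SignedIn s X φ
SignedIn s X (∀′ φ)      = SignedIn s X φ
SignedIn s X (lfp ψ _ _) = SignedIn s (suc X) ψ

module _ {n r : ℕ} (F : Relation n r → Vec (Fin n) r → Set) where

  IsFixedPoint : Relation n r → Set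
  IsFixedPoint X = ∀ xs → T (X xs) ⇔ F X xs

  IsLeastFixedPoint : Relation n r → Set
  IsLeastFixedPoint X =
    IsFixedPoint X × (∀ Y → IsFixedPoint Y → ∀ xs → T (X xs) → T (Y xs))

infix 4 _⊨ᴸ_[_]

_⊨ᴸ_[_] : ∀ {σ k} (𝔄 : Structure σ) → LFP σ k → Vec (Element 𝔄) k → Set
𝔄 ⊨ᴸ atom R ts [ a ]  = holds 𝔄 R (map (lookup a) ts)
𝔄 ⊨ᴸ (s ≐ t) [ a ]    = lookup a s ≡ lookup a t
𝔄 ⊨ᴸ (¬′ φ) [ a ]     = ¬ (𝔄 ⊨ᴸ φ [ a ])
𝔄 ⊨ᴸ (φ ∧′ ψ) [ a ]   = 𝔄 ⊨ᴸ φ [ a ] × 𝔄 ⊨ᴸ ψ [ a ]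
𝔄 ⊨ᴸ (φ ∨′ ψ) [ a ]   = 𝔄 ⊨ᴸ φ [ a ] ⊎ 𝔄 ⊨ᴸ ψ [ a ]
𝔄 ⊨ᴸ (∃′ φ) [ a ]     = ∃ λ (x : Element 𝔄) → 𝔄 ⊨ᴸ φ [ x ∷ a ]
𝔄 ⊨ᴸ (∀′ φ) [ a ]     = ∀ (x : Element 𝔄) → 𝔄 ⊨ᴸ φ [ x ∷ a ]
𝔄 ⊨ᴸ lfp ψ _ ts [ a ] =
  ∃ λ X → IsLeastFixedPoint (λ Y xs → (𝔄 ▸ Y) ⊨ᴸ ψ [ xs ++ a ]) X
        × T (X (map (lookup a) ts))

------------------------------------------------------------------------
-- Interpretations

-- An interpretation, with k parameters, of the vocabulary τ by formulas of
-- a logic for which L m is the set of formulas with m free variables.  The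
-- parameters are always the last k variables.
record Interpretation (L : ℕ → Set) (τ : Vocabulary) (k : ℕ) : Set where
  constructor interp
  field
    dim : ℕ
    φδ  : L (dim + k)
    φ≈  : L (dim + (dim + k))
    φS  : (S : Symbol τ) → L (arity τ S * dim + k)

-- What the formulas of a d-dimensional interpretation define over a set A
-- once the parameters are fixed.  Only the values of ε and S on tuples
-- satisfying δ matter.
record Defined (A : Set) (τ : Vocabulary) : Set₁ where
  field
    d : ℕ
    δ : Vec A d → Set
    ε : Vec A d → Vec A d → Set
    S : (R : Symbol τ) → Vec (Vec A d) (arity τ R) → Set

  -- The universe of the structure 𝔅.
  B : Set
  B = ∃ δ

  _≈_ : B → B → Set
  _≈_ = ε on proj₁

  Sᴮ : (R : Symbol τ) → Vec B (arity τ R) → Set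
  Sᴮ R bs = S R (map proj₁ bs)

  record IsCongruence : Set where
    field
      isEquivalence : IsEquivalence _≈_
      compatible    : ∀ R {bs cs} → Pointwise _≈_ bs cs → Sᴮ R bs → Sᴮ R cs

  -- ℭ is (isomorphic to) the quotient 𝔅/ℰ, with π the projection.
  record IsQuotient (ℭ : Structure τ) : Set where
    field
      π          : B → Element ℭ
      surjective : ∀ c → ∃ λ b → π b ≡ c
      kernel     : ∀ b b′ → π b ≡ π b′ ⇔ b ≈ b′
      relations  : ∀ R bs → holds ℭ R (map π bs) ⇔ Sᴮ R bs

  -- The quotient is defined and belongs to the (isomorphism-closed) class 𝒦.
  QuotientIn : (Structure τ → Set) → Set
  QuotientIn 𝒦 = IsCongruence × ∃ λ ℭ → IsQuotient ℭ × 𝒦 ℭ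

------------------------------------------------------------------------
-- First-order logic with a Lindström quantifier

-- FO⟨ τ ⟩ σ k: formulas of vocabulary σ, with free variables among k, of
-- the closure of first-order logic under a Lindström quantifier 𝒬 for a
-- class of τ-structures.  The class enters only in the semantics.

data FO⟨_⟩ (τ σ : Vocabulary) (k : ℕ) : Set where
  atom      : (R : Symbol σ) → Vec (Fin k) (arity σ R) → FO⟨ τ ⟩ σ k
  _≐_       : Fin k → Fin k → FO⟨ τ ⟩ σ k
  ¬′_       : FO⟨ τ ⟩ σ k → FO⟨ τ ⟩ σ k
  _∧′_ _∨′_ : FO⟨ τ ⟩ σ k → FO⟨ τ ⟩ σ k → FO⟨ τ ⟩ σ k
  ∃′ ∀′     : FO⟨ τ ⟩ σ (suc k) → FO⟨ τ ⟩ σ k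
  𝒬         : Interpretation (FO⟨ τ ⟩ σ) τ k → FO⟨ τ ⟩ σ k

-- The number of applications of the quantifier 𝒬.
#𝒬 : ∀ {τ σ k} → FO⟨ τ ⟩ σ k → ℕ
#𝒬 (atom _ _) = 0
#𝒬 (_ ≐ _)    = 0
#𝒬 (¬′ φ)     = #𝒬 φ
#𝒬 (φ ∧′ ψ)   = #𝒬 φ + #𝒬 ψ
#𝒬 (φ ∨′ ψ)   = #𝒬 φ + #𝒬 ψ
#𝒬 (∃′ φ)     = #𝒬 φ
#𝒬 (∀′ φ)     = #𝒬 φ
#𝒬 (𝒬 (interp _ φδ φ≈ φS)) =
  suc (#𝒬 φδ + #𝒬 φ≈ + Vec.sum (Vec.tabulate λ S → #𝒬 (φS S)))

IsFirstOrder : ∀ {τ σ k} → FO⟨ τ ⟩ σ k → Set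
IsFirstOrder φ = #𝒬 φ ≡ 0

record IsFirstOrderInterpretation {τ σ k}
         (I : Interpretation (FO⟨ τ ⟩ σ) τ k) : Set where
  open Interpretation I
  field
    foδ : IsFirstOrder φδ
    fo≈ : IsFirstOrder φ≈
    foS : ∀ S → IsFirstOrder (φS S)

module Semantics {τ : Vocabulary} (𝒦 : Structure τ → Set) where

  infix 4 _⊨_[_]

  _⊨_[_] : ∀ {σ k} (𝔄 : Structure σ) → FO⟨ τ ⟩ σ k → Vec (Element 𝔄) k → Set
  𝔄 ⊨ atom R ts [ a ] = holds 𝔄 R (map (lookup a) ts)
  𝔄 ⊨ (s ≐ t) [ a ]   = lookup a s ≡ lookup a t
  𝔄 ⊨ (¬′ φ) [ a ]    = ¬ (𝔄 ⊨ φ [ a ])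
  𝔄 ⊨ (φ ∧′ ψ) [ a ]  = 𝔄 ⊨ φ [ a ] × 𝔄 ⊨ ψ [ a ]
  𝔄 ⊨ (φ ∨′ ψ) [ a ]  = 𝔄 ⊨ φ [ a ] ⊎ 𝔄 ⊨ ψ [ a ]
  𝔄 ⊨ (∃′ φ) [ a ]    = ∃ λ (x : Element 𝔄) → 𝔄 ⊨ φ [ x ∷ a ]
  𝔄 ⊨ (∀′ φ) [ a ]    = ∀ (x : Element 𝔄) → 𝔄 ⊨ φ [ x ∷ a ]
  𝔄 ⊨ 𝒬 (interp dim φδ φ≈ φS) [ a ] = Defined.QuotientIn
    (record
      { d = dim
      ; δ = λ b → 𝔄 ⊨ φδ [ b ++ a ]
      ; ε = λ b b′ → 𝔄 ⊨ φ≈ [ b ++ (b′ ++ a) ]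
      ; S = λ S bs → 𝔄 ⊨ φS S [ concat bs ++ a ]
      })
    𝒦

------------------------------------------------------------------------
-- Propositional formulas in CNF and Horn resolution

-- A clause over m variables: the set of its positive literals and the set
-- of its negative literals.
record Clause (m : ℕ) : Set where
  constructor clause
  field
    positive : Sub.Subset m
    negative : Sub.Subset m

open Clause public

□ : ∀ {m} → Clause m
□ = clause Sub.⊥ Sub.⊥

record CNF : Set where
  field
    #vars   : ℕ
    clauses : List (Clause #vars)

open CNF public

IsHornClause : ∀ {m} → Clause m → Set
IsHornClause c = Sub.∣ positive c ∣ ≤ 1

IsHorn : CNF → Set
IsHorn ψ = All IsHornClause (clauses ψ)

-- The resolvent on x of c (containing x) and c′ (containing ¬x).
resolvent : ∀ {m} → Fin m → Clause m → Clause m → Clause m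
resolvent x c c′ = clause
  ((positive c Sub.- x) Sub.∪ positive c′)
  (negative c Sub.∪ (negative c′ Sub.- x))

data _⊢ᴴ_ {m : ℕ} (Γ : List (Clause m)) : Clause m → Set where
  axiom   : ∀ {c} → c ∈ Γ → Γ ⊢ᴴ c
  resolve : ∀ {c c′} (x : Fin m) →
            Γ ⊢ᴴ c → Γ ⊢ᴴ c′ → IsHornClause c → IsHornClause c′ →
            x Sub.∈ positive c → x Sub.∈ negative c′ →
            Γ ⊢ᴴ resolvent x c c′

-- The vocabulary {C, V, P, N}; the first argument of P and N is the
-- variable, the second one the clause.
hornVoc : Vocabulary
hornVoc = 1 ∷ 1 ∷ 2 ∷ 2 ∷ []

pattern symC = zero
pattern symV = suc zero
pattern symP = suc (suc zero)
pattern symN = suc (suc (suc zero))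

-- The clauses and the variables of a formula.
Item : CNF → Set
Item ψ = Fin (length (clauses ψ)) ⊎ Fin (#vars ψ)

module _ (ψ : CNF) where

  isClause isVariable : Item ψ → Set
  isClause (inj₁ _) = ⊤
  isClause (inj₂ _) = ⊥
  isVariable (inj₁ _) = ⊥
  isVariable (inj₂ _) = ⊤

  occursPos occursNeg : Item ψ → Item ψ → Set
  occursPos (inj₂ v) (inj₁ c) = v Sub.∈ positive (List.lookup (clauses ψ) c)
  occursPos _        _        = ⊥
  occursNeg (inj₂ v) (inj₁ c) = v Sub.∈ negative (List.lookup (clauses ψ) c)
  occursNeg _        _        = ⊥

-- 𝔄 is, up to renaming of its elements, the structure encoding ψ.
record Encodes (𝔄 : Structure hornVoc) (ψ : CNF) : Set where
  field
    items : Element 𝔄 ↔ Item ψ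

  private
    item : Element 𝔄 → Item ψ
    item = Inverse.to items

  field
    encC : ∀ x   → holds 𝔄 symC (x ∷ [])     ⇔ isClause ψ (item x)
    encV : ∀ x   → holds 𝔄 symV (x ∷ [])     ⇔ isVariable ψ (item x)
    encP : ∀ x y → holds 𝔄 symP (x ∷ y ∷ []) ⇔ occursPos ψ (item x) (item y)
    encN : ∀ x y → holds 𝔄 symN (x ∷ y ∷ []) ⇔ occursNeg ψ (item x) (item y)

HornRes : Structure hornVoc → Set
HornRes 𝔄 = Σ[ ψ ∈ CNF ] (Encodes 𝔄 ψ × IsHorn ψ × clauses ψ ⊢ᴴ □)

------------------------------------------------------------------------
-- FO(Horn-Res)

FO-HornRes : Vocabulary → ℕ → Set
FO-HornRes = FO⟨ hornVoc ⟩

open Semantics HornRes public using () renaming (_⊨_[_] to _⊨ᴴ_[_])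

_IsEquivalentTo_ : ∀ {σ k} → FO-HornRes σ k → LFP σ k → Set
_IsEquivalentTo_ {σ} {k} χ φ =
  (𝔄 : Structure σ) (a : Vec (Element 𝔄) k) → 𝔄 ⊨ᴴ χ [ a ] ⇔ 𝔄 ⊨ᴸ φ [ a ]

-- Both φ and ¬ φ are evaluated by rules that never negate a derived predicate.
-- The difficulty is the negation of a least fixed point, possibly inside other
-- fixed points.  A stage of an induction is named by a cut: the empty
-- stage, or the first stage containing y.  For such a cut c the rules derive
--   z ∈ c and z ∉ c,
-- where for the first stage c containing y one guesses a cut c′ of the
-- previous stage, certified by y ∉ c′ and ψ(c′, y), and then evaluates ψ(c′, z)
-- or ¬ ψ(c′, z).  Now z is in the fixed point iff z ∈ c for some c, and outside
-- iff z ∉ c for some c that is closed: every u satisfies u ∈ c or ¬ ψ(c, u).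
-- Cuts naming no stage derive nothing false, because rules are monotone.
-- The rules form an and-or graph that is first-order definable on tuples,
-- and its derivable vertices are the units derivable by Horn resolution from
-- clauses indexed by pairs of vertices.  Tags of vertices are encoded by
-- equalities between coordinates, which requires two distinct elements;
-- structures with a single element are treated separately.
module Submission where

open import Defs
open import Data.Bool.Base using (Bool; true; false; T; if_then_else_)
open import Data.Bool.Properties using (T?)
open import Data.Empty using (⊥; ⊥-elim)
open import Data.Fin.Base using (Fin; zero; suc; _↑ˡ_; _↑ʳ_; cast)
import Data.Fin.Properties as Finₚ
open import Data.Fin.Properties using (_≟_; any?; all?; +↔⊎; *↔×; 0↔⊥; 1↔⊤)
import Data.Fin.Subset as Sub
import Data.Fin.Subset.Properties as Subₚ
open import Data.List.Base using (List; []; _∷_; length)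
import Data.List.Base as List
import Data.List.Properties as Listₚ
open import Data.List.Membership.Propositional using (_∈_)
import Data.List.Membership.Propositional.Properties as Memₚ
import Data.List.Relation.Unary.All.Properties as Allₚ
import Data.List.Relation.Unary.Any as Any
import Data.List.Relation.Unary.Any.Properties as Anyₚ
open import Data.Maybe.Base as Maybe using (Maybe; just; nothing)
import Data.Maybe.Properties as Maybeₚ
open import Data.Nat.Base using (ℕ; zero; suc; _+_; _*_; _≤_; _<_; z≤n; s≤s; NonZero)
import Data.Nat.Properties as ℕₚ
open import Data.Product.Base using (Σ-syntax; ∃; ∃₂; _×_; _,_; proj₁; proj₂; map₂)
open import Data.Product.Function.NonDependent.Propositional using (_×-⇔_; _×-↔_)
open import Data.Sign.Base using (Sign; opposite) renaming (+ to pos; - to neg)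
import Data.Sign.Properties as Signₚ
open import Data.Sum.Base as Sum using (_⊎_; inj₁; inj₂; [_,_]′)
import Data.Sum.Properties as Sumₚ
open import Data.Sum.Function.Propositional using (_⊎-⇔_; _⊎-↔_)
open import Data.Unit.Base using (⊤; tt)
open import Data.Vec.Base as Vec using (Vec; []; _∷_; _++_; lookup; map; concat)
import Data.Vec.Properties as Vecₚ
open import Function.Base using (_∘_; id; case_of_)
open import Function.Bundles using (_⇔_; _↔_; Injection; Inverse; Equivalence; mk⇔; mk↔ₛ′)
open import Function.Construct.Composition using (_⇔-∘_; _↔-∘_)
open import Function.Properties.Inverse using (↔⇒↣)
open import Function.Construct.Identity using (⇔-id; ↔-id)
open import Function.Construct.Symmetry using (⇔-sym)
open import Relation.Binary.Definitions using (tri<; tri≈; tri>)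
open import Relation.Binary.PropositionalEquality.Core using (_≡_; _≢_; refl; sym; trans; cong; cong₂; subst)
open import Relation.Nullary.Decidable.Core
  using (Dec; yes; no; does; ¬?; _×-dec_; _⊎-dec_; toWitness; fromWitness; ⌊_⌋; map′)
open import Relation.Nullary.Negation.Core using (¬_; contradiction)

open import Data.Vec.Relation.Binary.Pointwise.Inductive using ([]; _∷_)

open Equivalence using (to; from)

-- Horn derivability is itself a least fixed point, so it can enumerate facts but not complement
-- them, and dualising the rules of a fixed point would turn it into a greatest one. Finiteness is
-- what makes negative facts enumerable: membership and non-membership in a stage are both settled
-- by the preceding stage, a well-founded recursion, as in the stage comparison method. A tuple that
-- enters at a stage serves as its name, which replaces a linear order or a counter. The certificate
-- y ∉ c′, ψ(c′, y) says that y enters immediately after c′, so c is the successor of c′. A closed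
-- stage contains the whole fixed point, so exhibiting one suffices to refute membership. The rules
-- are judged against arbitrary valuations closed under them: soundness exhibits one closed
-- valuation, the intended meaning; completeness shows that, when the formula holds and two elements
-- differ, every closed valuation contains the root. Horn resolution then enters only through the
-- fact that its derivable units form a closed valuation and lie below all others.

-- Stages of a monotone operator on a finite set

module _ {n : ℕ} where

  anyVec? : ∀ {r} {P : Vec (Fin n) r → Set} → (∀ xs → Dec (P xs)) → Dec (∃ P)
  anyVec? {zero}  P? = map′ ([] ,_) (λ { ([] , p) → p }) (P? [])
  anyVec? {suc r} P? =
    map′ (λ { (x , xs , p) → x ∷ xs , p }) (λ { (x ∷ xs , p) → x , xs , p })
         (any? λ x → anyVec? λ xs → P? (x ∷ xs))

  _⊆_ : ∀ {r} → Relation n r → Relation n r → Set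
  X ⊆ Y = ∀ xs → T (X xs) → T (Y xs)

  sumFin : (Fin n → ℕ) → ℕ
  sumFin f = Vec.sum (Vec.tabulate f)

sum-mono-≤ : ∀ {n} {f g : Fin n → ℕ} → (∀ i → f i ≤ g i) → sumFin f ≤ sumFin g
sum-mono-≤ {zero}  f≤g = z≤n
sum-mono-≤ {suc n} f≤g = ℕₚ.+-mono-≤ (f≤g zero) (sum-mono-≤ (f≤g ∘ suc))

sum-mono-< : ∀ {n} {f g : Fin n → ℕ} → (∀ i → f i ≤ g i) → (∃ λ i → f i < g i) → sumFin f < sumFin g
sum-mono-< f≤g (zero  , f<g) = ℕₚ.+-mono-<-≤ f<g (sum-mono-≤ (f≤g ∘ suc))
sum-mono-< f≤g (suc i , f<g) = ℕₚ.+-mono-≤-< (f≤g zero) (sum-mono-< (f≤g ∘ suc) (i , f<g))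

∣_∣ʳ : ∀ {n r} → Relation n r → ℕ
∣_∣ʳ {r = zero}  X = if X [] then 1 else 0
∣_∣ʳ {r = suc r} X = sumFin λ x → ∣ (λ xs → X (x ∷ xs)) ∣ʳ

∣∣ʳ-mono-≤ : ∀ {n r} {X Y : Relation n r} → X ⊆ Y → ∣ X ∣ʳ ≤ ∣ Y ∣ʳ
∣∣ʳ-mono-≤ {r = zero} {X} {Y} X⊆Y with X [] | Y [] | X⊆Y []
... | false | _     | _ = z≤n
... | true  | true  | _ = ℕₚ.≤-refl
... | true  | false | f = ⊥-elim (f tt)
∣∣ʳ-mono-≤ {r = suc r} X⊆Y = sum-mono-≤ λ x → ∣∣ʳ-mono-≤ (λ xs → X⊆Y (x ∷ xs))

∣∣ʳ-mono-< : ∀ {n r} {X Y : Relation n r} → X ⊆ Y →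
             (∃ λ xs → T (Y xs) × ¬ T (X xs)) → ∣ X ∣ʳ < ∣ Y ∣ʳ
∣∣ʳ-mono-< {r = zero} {X} {Y} X⊆Y ([] , y , ¬x) with X [] | Y []
... | false | true = s≤s z≤n
... | true  | _    = contradiction tt ¬x
∣∣ʳ-mono-< {r = suc r} X⊆Y (x ∷ xs , y , ¬x) =
  sum-mono-< (λ x → ∣∣ʳ-mono-≤ (λ xs → X⊆Y (x ∷ xs))) (x , ∣∣ʳ-mono-< (λ xs → X⊆Y (x ∷ xs)) (xs , y , ¬x))

module Stages {n r : ℕ} (F : Relation n r → Vec (Fin n) r → Set)
              (F? : ∀ X xs → Dec (F X xs))
              (F-mono : ∀ X Y → X ⊆ Y → ∀ xs → F X xs → F Y xs) where

  stage : ℕ → Relation n r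
  stage zero    _  = false
  stage (suc i) xs = ⌊ F? (stage i) xs ⌋

  stage-suc⁺ : ∀ i xs → F (stage i) xs → T (stage (suc i) xs)
  stage-suc⁺ i xs = fromWitness

  stage-suc⁻ : ∀ i xs → T (stage (suc i) xs) → F (stage i) xs
  stage-suc⁻ i xs = toWitness

  stage-⊆-suc : ∀ i → stage i ⊆ stage (suc i)
  stage-⊆-suc (suc i) xs p =
    stage-suc⁺ (suc i) xs (F-mono _ _ (stage-⊆-suc i) xs (stage-suc⁻ i xs p))

  stage-mono : ∀ {i j} → i ≤ j → stage i ⊆ stage j
  stage-mono {j = zero} z≤n xs p = p
  stage-mono {i} {suc j} i≤1+j xs p with ℕₚ.m≤n⇒m<n∨m≡n i≤1+j
  ... | inj₁ (s≤s i≤j) = stage-⊆-suc j xs (stage-mono i≤j xs p)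
  ... | inj₂ refl      = p

  stage-⊆-prefixed : ∀ {Y} → (∀ xs → F Y xs → T (Y xs)) → ∀ i → stage i ⊆ Y
  stage-⊆-prefixed pre (suc i) xs p =
    pre xs (F-mono _ _ (stage-⊆-prefixed pre i) xs (stage-suc⁻ i xs p))

  New : ℕ → Vec (Fin n) r → Set
  New i xs = T (stage (suc i) xs) × ¬ T (stage i xs)

  new? : ∀ i → Dec (∃ (New i))
  new? i = anyVec? λ xs → T? (stage (suc i) xs) ×-dec ¬? (T? (stage i xs))

  stable : ∀ {i} → ¬ ∃ (New i) → stage (suc i) ⊆ stage i
  stable {i} ¬new xs p with T? (stage i xs)
  ... | yes q = q
  ... | no ¬q = contradiction (xs , p , ¬q) ¬new

  -- Every step that adds a tuple raises the cardinality by at least one, so as long as no stage is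
  -- stable the cardinality keeps up with the index.
  growing : ∀ i → (∃ λ j → ¬ ∃ (New j)) ⊎ i ≤ ∣ stage i ∣ʳ
  growing zero = inj₂ z≤n
  growing (suc i) with growing i | new? i
  ... | inj₁ p   | _       = inj₁ p
  ... | inj₂ _   | no ¬new = inj₁ (i , ¬new)
  ... | inj₂ i≤m | yes new = inj₂ (ℕₚ.≤-<-trans i≤m (∣∣ʳ-mono-< (stage-⊆-suc i) new))

  everything : Relation n r
  everything _ = true

  stabilises : ∃ λ N → stage (suc N) ⊆ stage N
  -- An index above the cardinality of the full relation rules out the second alternative.
  stabilises with growing (suc ∣ everything ∣ʳ)
  ... | inj₁ (N , ¬new) = N , stable {N} ¬new
  ... | inj₂ p = contradiction p (ℕₚ.<⇒≱ (s≤s (∣∣ʳ-mono-≤ {X = stage (suc ∣ everything ∣ʳ)} λ _ _ → tt)))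

  N∞ : ℕ
  N∞ = proj₁ stabilises

  prefixed : ∀ xs → F (stage N∞) xs → T (stage N∞ xs)
  prefixed xs = proj₂ stabilises xs ∘ stage-suc⁺ N∞ xs

  stage-⊆-N∞ : ∀ i → stage i ⊆ stage N∞
  stage-⊆-N∞ = stage-⊆-prefixed prefixed

  isFixedPoint : IsFixedPoint F (stage N∞)
  isFixedPoint xs = mk⇔ (stage-suc⁻ N∞ xs ∘ stage-⊆-suc N∞ xs) (prefixed xs)

  -- Trades the relation in the semantics of `lfp` for a stage index: deciding a formula uses the
  -- single index `N∞`, whereas cuts name arbitrary stages.
  lfp⇔stage : ∀ xs → (∃ λ X → IsLeastFixedPoint F X × T (X xs)) ⇔ ∃ λ i → T (stage i xs)
  lfp⇔stage xs = mk⇔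
    (λ { (X , (_ , least) , x) → N∞ , least _ isFixedPoint xs x })
    (λ { (i , p) → stage N∞
                 , (isFixedPoint , λ Y fix → stage-⊆-prefixed (from ∘ fix) N∞)
                 , stage-⊆-N∞ i xs p })

-- Decidability and monotonicity of LFP-formulas

record Relations (σ : Vocabulary) (n : ℕ) : Set where
  constructor mkRelations
  field _at_ : (R : Symbol σ) → Relation n (arity σ R)

open Relations

Signed : Sign → Set → Set
Signed pos P = P
Signed neg P = ¬ P

signed-map : ∀ s {P Q : Set} → P ⇔ Q → Signed s P → Signed s Q
signed-map pos e p  = to e p
signed-map neg e ¬p = ¬p ∘ from e

Implies : Sign → Set → Set → Set
Implies pos P Q = P → Q
Implies neg P Q = Q → P

module LFP-Semantics {n : ℕ} (n≢0 : NonZero n) where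

  ⟨_⟩ : ∀ {σ} → Relations σ n → Structure σ
  ⟨ A ⟩ = record { size = n ; nonEmpty = n≢0 ; rel = A at_ }

  _▹_ : ∀ {σ r} → Relations σ n → Relation n r → Relations (r ∷ σ) n
  A ▹ Y = mkRelations (rel (⟨ A ⟩ ▸ Y))

  tail : ∀ {σ r} → Relations (r ∷ σ) n → Relations σ n
  tail A = mkRelations λ R → A at (suc R)

  ▹-mono : ∀ {σ r} {A B : Relations σ n} {X Y : Relation n r} →
           (∀ R → (A at R) ⊆ (B at R)) → X ⊆ Y → ∀ R → ((A ▹ X) at R) ⊆ ((B ▹ Y) at R)
  ▹-mono A⊆B X⊆Y zero    = X⊆Y
  ▹-mono A⊆B X⊆Y (suc R) = A⊆B R

  Operator : ∀ {σ k r} → LFP (r ∷ σ) (r + k) → Relations σ n → Vec (Fin n) k →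
             Relation n r → Vec (Fin n) r → Set
  Operator ψ A a Y xs = ⟨ A ▹ Y ⟩ ⊨ᴸ ψ [ xs ++ a ]

  -- Mutual with `monotone`: `lfp` is computed by stages only once its operator is known to be
  -- decidable and monotone, and both facts recurse through the body.
  _⊨?_[_] : ∀ {σ k} (A : Relations σ n) (φ : LFP σ k) a → Dec (⟨ A ⟩ ⊨ᴸ φ [ a ])

  -- Only `X` may grow from `A` to `B`. The other symbols can occur with both signs, so inclusions
  -- in both directions are assumed for them.
  monotone : ∀ {σ k} (φ : LFP σ k) X s → SignedIn s X φ → {A B : Relations σ n} →
             (∀ R → (A at R) ⊆ (B at R)) → (∀ R → R ≢ X → (B at R) ⊆ (A at R)) →
             ∀ a → Implies s (⟨ A ⟩ ⊨ᴸ φ [ a ]) (⟨ B ⟩ ⊨ᴸ φ [ a ])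

  operator-mono : ∀ {σ k r} (ψ : LFP (r ∷ σ) (r + k)) → PositiveIn zero ψ → ∀ A a X Y →
                  X ⊆ Y → ∀ xs → Operator ψ A a X xs → Operator ψ A a Y xs
  operator-mono ψ p A a X Y X⊆Y xs =
    monotone ψ zero pos p (▹-mono {A = A} (λ _ _ → id) X⊆Y)
      (λ { zero R≢X → contradiction refl R≢X ; (suc R) _ _ → id }) (xs ++ a)

  module LFP-Stages {σ k r} (ψ : LFP (r ∷ σ) (r + k)) (p : PositiveIn zero ψ)
                    (A : Relations σ n) (a : Vec (Fin n) k) =
    Stages (Operator ψ A a) (λ X xs → (A ▹ X) ⊨? ψ [ xs ++ a ]) (operator-mono ψ p A a)

  A ⊨? atom R ts [ a ] = T? _
  A ⊨? s ≐ t [ a ]     = lookup a s ≟ lookup a t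
  A ⊨? ¬′ φ [ a ]      = ¬? (A ⊨? φ [ a ])
  A ⊨? φ ∧′ ψ [ a ]    = (A ⊨? φ [ a ]) ×-dec (A ⊨? ψ [ a ])
  A ⊨? φ ∨′ ψ [ a ]    = (A ⊨? φ [ a ]) ⊎-dec (A ⊨? ψ [ a ])
  A ⊨? ∃′ φ [ a ]      = any? λ x → A ⊨? φ [ x ∷ a ]
  A ⊨? ∀′ φ [ a ]      = all? λ x → A ⊨? φ [ x ∷ a ]
  A ⊨? lfp ψ p ts [ a ] =
    map′ (λ t → from (lfp⇔stage (map (lookup a) ts)) (N∞ , t))
         (λ l → let i , t = to (lfp⇔stage (map (lookup a) ts)) l in stage-⊆-N∞ i _ t)
         (T? (stage N∞ (map (lookup a) ts)))
    where open LFP-Stages ψ p A a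

  monotone (atom R ts) X pos sg A⊆B B⊆A a = A⊆B R _
  monotone (atom R ts) X neg sg A⊆B B⊆A a = B⊆A R (λ R≡X → case sg R≡X of λ ()) _
  monotone (s ≐ t) X pos sg A⊆B B⊆A a = id
  monotone (s ≐ t) X neg sg A⊆B B⊆A a = id
  monotone (¬′ φ) X pos sg A⊆B B⊆A a ¬p p = ¬p (monotone φ X neg sg A⊆B B⊆A a p)
  monotone (¬′ φ) X neg sg A⊆B B⊆A a ¬p p = ¬p (monotone φ X pos sg A⊆B B⊆A a p)
  monotone (φ ∧′ ψ) X pos (sg , sg′) A⊆B B⊆A a (p , q) =
    monotone φ X pos sg A⊆B B⊆A a p , monotone ψ X pos sg′ A⊆B B⊆A a q
  monotone (φ ∧′ ψ) X neg (sg , sg′) A⊆B B⊆A a (p , q) =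
    monotone φ X neg sg A⊆B B⊆A a p , monotone ψ X neg sg′ A⊆B B⊆A a q
  monotone (φ ∨′ ψ) X pos (sg , sg′) A⊆B B⊆A a =
    Sum.map (monotone φ X pos sg A⊆B B⊆A a) (monotone ψ X pos sg′ A⊆B B⊆A a)
  monotone (φ ∨′ ψ) X neg (sg , sg′) A⊆B B⊆A a =
    Sum.map (monotone φ X neg sg A⊆B B⊆A a) (monotone ψ X neg sg′ A⊆B B⊆A a)
  monotone (∃′ φ) X pos sg A⊆B B⊆A a (x , p) = x , monotone φ X pos sg A⊆B B⊆A (x ∷ a) p
  monotone (∃′ φ) X neg sg A⊆B B⊆A a (x , p) = x , monotone φ X neg sg A⊆B B⊆A (x ∷ a) p
  monotone (∀′ φ) X pos sg A⊆B B⊆A a p x = monotone φ X pos sg A⊆B B⊆A (x ∷ a) (p x)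
  monotone (∀′ φ) X neg sg A⊆B B⊆A a p x = monotone φ X neg sg A⊆B B⊆A (x ∷ a) (p x)
  monotone (lfp ψ p ts) X s sg {A} {B} A⊆B B⊆A a = go s sg
    where
    module SA = LFP-Stages ψ p A a
    module SB = LFP-Stages ψ p B a
    operators : ∀ s → SignedIn s (suc X) ψ → ∀ Y xs → Implies s (Operator ψ A a Y xs) (Operator ψ B a Y xs)
    operators s sg Y xs =
      monotone ψ (suc X) s sg (▹-mono {A = A} {B = B} A⊆B (λ _ → id))
        (λ { zero _ _ → id ; (suc R) R≢X → B⊆A R (R≢X ∘ cong suc) }) (xs ++ a)
    go : ∀ s → SignedIn s (suc X) ψ → Implies s (⟨ A ⟩ ⊨ᴸ lfp ψ p ts [ a ]) (⟨ B ⟩ ⊨ᴸ lfp ψ p ts [ a ])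
    -- The operator over `A` lies below the one over `B`, so the last stage over `B` is prefixed for
    -- it and bounds all stages over `A`. The negative case exchanges the roles.
    go pos sg l = let i , t = to (SA.lfp⇔stage (map (lookup a) ts)) l in
      from (SB.lfp⇔stage (map (lookup a) ts))
        (SB.N∞ , SA.stage-⊆-prefixed (λ xs q → SB.prefixed xs (operators pos sg _ xs q)) i _ t)
    go neg sg l = let i , t = to (SB.lfp⇔stage (map (lookup a) ts)) l in
      from (SA.lfp⇔stage (map (lookup a) ts))
        (SA.N∞ , SB.stage-⊆-prefixed (λ xs q → SA.prefixed xs (operators neg sg _ xs q)) i _ t)

-- Tuples of variables or of elements, structured by shapes

data Shape : Set where
  vec : ℕ → Shape
  _⊗_ : Shape → Shape → Shape

infixr 5 _⊗_

-- Serves both for tuples of variables and for tuples of elements; `rename s (lookup ρ)` evaluates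
-- the former. Nested products avoid reasoning about sums of lengths until `flatten`.
Tuple : Shape → ℕ → Set
Tuple (vec k) n = Vec (Fin n) k
Tuple (s ⊗ t) n = Tuple s n × Tuple t n

width : Shape → ℕ
width (vec k) = k
width (s ⊗ t) = width s + width t

rename : ∀ s {m n} → (Fin m → Fin n) → Tuple s m → Tuple s n
rename (vec k) f xs      = map f xs
rename (s ⊗ t) f (x , y) = rename s f x , rename t f y

rename-∘ : ∀ s {l m n} {f : Fin m → Fin n} {g : Fin l → Fin m} {h : Fin l → Fin n} →
           (∀ i → f (g i) ≡ h i) → ∀ x → rename s f (rename s g x) ≡ rename s h x
rename-∘ (vec k) f∘g≗h x = trans (sym (Vecₚ.map-∘ _ _ x)) (Vecₚ.map-cong f∘g≗h x)
rename-∘ (s ⊗ t) f∘g≗h (x , y) = cong₂ _,_ (rename-∘ s f∘g≗h x) (rename-∘ t f∘g≗h y)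

rename-id : ∀ s {n} {f : Fin n → Fin n} → (∀ i → f i ≡ i) → ∀ x → rename s f x ≡ x
rename-id (vec k) f≗id x = trans (Vecₚ.map-cong f≗id x) (Vecₚ.map-id x)
rename-id (s ⊗ t) f≗id (x , y) = cong₂ _,_ (rename-id s f≗id x) (rename-id t f≗id y)

unflatten : ∀ s {n} → Vec (Fin n) (width s) → Tuple s n
unflatten (vec k) xs = xs
unflatten (s ⊗ t) xs = unflatten s (Vec.take (width s) xs) , unflatten t (Vec.drop (width s) xs)

flatten : ∀ s {n} → Tuple s n → Vec (Fin n) (width s)
flatten (vec k) x       = x
flatten (s ⊗ t) (x , y) = flatten s x ++ flatten t y

take-++ : ∀ {A : Set} {m n} (xs : Vec A m) (ys : Vec A n) → Vec.take m (xs ++ ys) ≡ xs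
take-++ {m = m} xs ys = Vecₚ.++-injectiveˡ (Vec.take m (xs ++ ys)) xs (Vecₚ.take++drop≡id m (xs ++ ys))

drop-++ : ∀ {A : Set} {m n} (xs : Vec A m) (ys : Vec A n) → Vec.drop m (xs ++ ys) ≡ ys
drop-++ {m = m} xs ys = Vecₚ.++-injectiveʳ (Vec.take m (xs ++ ys)) xs (Vecₚ.take++drop≡id m (xs ++ ys))

unflatten-flatten : ∀ s {n} (x : Tuple s n) → unflatten s (flatten s x) ≡ x
unflatten-flatten (vec k) x = refl
unflatten-flatten (s ⊗ t) (x , y)
  rewrite take-++ (flatten s x) (flatten t y) | drop-++ (flatten s x) (flatten t y) =
  cong₂ _,_ (unflatten-flatten s x) (unflatten-flatten t y)

rename-unflatten : ∀ s {m n} (f : Fin m → Fin n) xs →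
                   rename s f (unflatten s xs) ≡ unflatten s (map f xs)
rename-unflatten (vec k) f xs = refl
rename-unflatten (s ⊗ t) f xs = cong₂ _,_
  (trans (rename-unflatten s f _) (cong (unflatten s) (sym (Vecₚ.take-map f (width s) xs))))
  (trans (rename-unflatten t f _) (cong (unflatten t) (sym (Vecₚ.drop-map f (width s) xs))))

lookup-↑ˡ : ∀ {A : Set} {m n r} (xs : Vec A m) (ys : Vec A n) (ts : Vec (Fin m) r) →
            map (lookup (xs ++ ys)) (map (_↑ˡ n) ts) ≡ map (lookup xs) ts
lookup-↑ˡ xs ys ts = trans (sym (Vecₚ.map-∘ _ _ ts)) (Vecₚ.map-cong (Vecₚ.lookup-++ˡ xs ys) ts)

lookup-↑ʳ : ∀ {A : Set} {m n r} (xs : Vec A m) (ys : Vec A n) (ts : Vec (Fin n) r) →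
            map (lookup (xs ++ ys)) (map (m ↑ʳ_) ts) ≡ map (lookup ys) ts
lookup-↑ʳ xs ys ts = trans (sym (Vecₚ.map-∘ _ _ ts)) (Vecₚ.map-cong (Vecₚ.lookup-++ʳ xs ys) ts)

inhabitant : ∀ s {n} → Fin n → Tuple s n
inhabitant (vec k) x = Vec.replicate k x
inhabitant (s ⊗ t) x = inhabitant s x , inhabitant t x

-- First-order definable predicates

Predicate : Vocabulary → ℕ → Set₁
Predicate σ m = (𝔄 : Structure σ) → Vec (Element 𝔄) m → Set

-- Indexing by the semantic predicate lets a definition be assembled along the predicate, without
-- writing formulas out. Substitution into formulas is avoided too: variables are renamed in the
-- tuples from which a formula is built.
record Definable {σ : Vocabulary} {m : ℕ} (R : Predicate σ m) : Set₁ where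
  constructor definable
  field
    formula    : FO-HornRes σ m
    firstOrder : IsFirstOrder formula
    defines    : ∀ 𝔄 ρ → 𝔄 ⊨ᴴ formula [ ρ ] ⇔ R 𝔄 ρ

open Definable

∀-cong-⇔ : ∀ {A : Set} {P Q : A → Set} → (∀ x → P x ⇔ Q x) → (∀ x → P x) ⇔ (∀ x → Q x)
∀-cong-⇔ e = mk⇔ (λ p x → to (e x) (p x)) (λ q x → from (e x) (q x))

∃-cong-⇔ : ∀ {A : Set} {P Q : A → Set} → (∀ x → P x ⇔ Q x) → ∃ P ⇔ ∃ Q
∃-cong-⇔ e = mk⇔ (map₂ (to (e _))) (map₂ (from (e _)))

¬-cong-⇔ : ∀ {P Q : Set} → P ⇔ Q → (¬ P) ⇔ (¬ Q)
¬-cong-⇔ e = mk⇔ (_∘ from e) (_∘ to e)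

≡⇒⇔ : ∀ {P Q : Set} → P ≡ Q → P ⇔ Q
≡⇒⇔ refl = ⇔-id _

module _ {σ : Vocabulary} where

  ⇔ᵈ : ∀ {m} {R S : Predicate σ m} → (∀ 𝔄 ρ → R 𝔄 ρ ⇔ S 𝔄 ρ) → Definable R → Definable S
  ⇔ᵈ e (definable φ fo d) = definable φ fo λ 𝔄 ρ → e 𝔄 ρ ⇔-∘ d 𝔄 ρ

  atomᵈ : ∀ {m} (R : Symbol σ) (ts : Vec (Fin m) (arity σ R)) →
          Definable {σ} λ 𝔄 ρ → holds 𝔄 R (map (lookup ρ) ts)
  atomᵈ R ts = definable (atom R ts) refl λ 𝔄 ρ → mk⇔ id id

  ≐ᵈ : ∀ {m} (s t : Fin m) → Definable {σ} λ 𝔄 ρ → lookup ρ s ≡ lookup ρ t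
  ≐ᵈ s t = definable (s ≐ t) refl λ 𝔄 ρ → ⇔-id _

  ¬ᵈ : ∀ {m} {R : Predicate σ m} → Definable R → Definable λ 𝔄 ρ → ¬ R 𝔄 ρ
  ¬ᵈ (definable φ fo d) = definable (¬′ φ) fo λ 𝔄 ρ → ¬-cong-⇔ (d 𝔄 ρ)

  _×ᵈ_ : ∀ {m} {R S : Predicate σ m} → Definable R → Definable S →
         Definable λ 𝔄 ρ → R 𝔄 ρ × S 𝔄 ρ
  definable φ fo d ×ᵈ definable ψ fo′ d′ =
    definable (φ ∧′ ψ) (cong₂ _+_ fo fo′) λ 𝔄 ρ → d 𝔄 ρ ×-⇔ d′ 𝔄 ρ

  _⊎ᵈ_ : ∀ {m} {R S : Predicate σ m} → Definable R → Definable S →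
         Definable λ 𝔄 ρ → R 𝔄 ρ ⊎ S 𝔄 ρ
  definable φ fo d ⊎ᵈ definable ψ fo′ d′ =
    definable (φ ∨′ ψ) (cong₂ _+_ fo fo′) λ 𝔄 ρ → d 𝔄 ρ ⊎-⇔ d′ 𝔄 ρ

  ∃ᵈ : ∀ {m} {R : (𝔄 : Structure σ) → Element 𝔄 → Vec (Element 𝔄) m → Set} →
       Definable (λ 𝔄 ρ → R 𝔄 (Vec.head ρ) (Vec.tail ρ)) → Definable λ 𝔄 ρ → ∃ λ x → R 𝔄 x ρ
  ∃ᵈ (definable φ fo d) = definable (∃′ φ) fo λ 𝔄 ρ → ∃-cong-⇔ λ x → d 𝔄 (x ∷ ρ)

  ∀ᵈ : ∀ {m} {R : (𝔄 : Structure σ) → Element 𝔄 → Vec (Element 𝔄) m → Set} →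
       Definable (λ 𝔄 ρ → R 𝔄 (Vec.head ρ) (Vec.tail ρ)) → Definable λ 𝔄 ρ → ∀ x → R 𝔄 x ρ
  ∀ᵈ (definable φ fo d) = definable (∀′ φ) fo λ 𝔄 ρ → ∀-cong-⇔ λ x → d 𝔄 (x ∷ ρ)

  ⊤ᵈ : ∀ {m} → Definable {σ} {m} λ 𝔄 ρ → ⊤
  ⊤ᵈ = definable (∀′ (zero ≐ zero)) refl λ 𝔄 ρ → mk⇔ _ (λ _ _ → refl)

  ⊥ᵈ : ∀ {m} → Definable {σ} {m} λ 𝔄 ρ → ⊥
  ⊥ᵈ = ⇔ᵈ (λ 𝔄 ρ → mk⇔ (λ f → f tt) λ ()) (¬ᵈ ⊤ᵈ)

  signedᵈ : ∀ {m} s {R : Predicate σ m} → Definable R → Definable λ 𝔄 ρ → Signed s (R 𝔄 ρ)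
  signedᵈ pos D = D
  signedᵈ neg D = ¬ᵈ D

  ∃Finᵈ : ∀ {m} c {R : Fin c → Predicate σ m} → (∀ i → Definable (R i)) →
          Definable λ 𝔄 ρ → ∃ λ i → R i 𝔄 ρ
  ∃Finᵈ zero    D = ⇔ᵈ (λ 𝔄 ρ → mk⇔ (λ ()) (λ ())) ⊥ᵈ
  ∃Finᵈ (suc c) D = ⇔ᵈ
    (λ 𝔄 ρ → mk⇔ [ zero ,_ , (λ { (i , p) → suc i , p }) ]′
                 (λ { (zero , p) → inj₁ p ; (suc i , p) → inj₂ (i , p) }))
    (D zero ⊎ᵈ ∃Finᵈ c (D ∘ suc))

  -- Each quantifier shifts the variables in use, which is why the hypothesis ranges over all `m`.
  -- The induction moves the variable just bound into the tuple `x`, so the shape has to vary.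
  ∃Vecᵈ : ∀ {m} k {s} {R : (𝔄 : Structure σ) → Vec (Element 𝔄) k → Tuple s (size 𝔄) → Set} →
          (∀ {m} (z : Vec (Fin m) k) (x : Tuple s m) →
             Definable λ 𝔄 (ρ : Vec _ m) → R 𝔄 (map (lookup ρ) z) (rename s (lookup ρ) x)) →
          (x : Tuple s m) → Definable λ 𝔄 ρ → ∃ λ z → R 𝔄 z (rename s (lookup ρ) x)
  ∃Vecᵈ {m} zero {s} D x = ⇔ᵈ (λ 𝔄 ρ → mk⇔ ([] ,_) (λ { ([] , p) → p })) (D [] x)
  ∃Vecᵈ {m} (suc k) {s} {R} D x =
    ⇔ᵈ (λ 𝔄 ρ → mk⇔ (λ { (y , z , p) → y ∷ z , p }) (λ { (y ∷ z , p) → y , z , p }))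
       (∃ᵈ {R = λ 𝔄 y ρ → ∃ λ z → R 𝔄 (y ∷ z) (rename s (lookup ρ) x)}
         (⇔ᵈ (λ { 𝔄 (y ∷ ρ) → ∃-cong-⇔ λ z → ≡⇒⇔ (cong (R 𝔄 (y ∷ z)) (rename-∘ s (λ _ → refl) x)) })
           (∃Vecᵈ k {vec 1 ⊗ s} {λ { 𝔄 z (y ∷ [] , x) → R 𝔄 (y ∷ z) x }}
              (λ { z (y ∷ [] , x) → D (y ∷ z) x }) (zero ∷ [] , rename s suc x))))

  tuple≡ᵈ : ∀ s {m} (x y : Tuple s m) →
            Definable {σ} λ 𝔄 ρ → rename s (lookup ρ) x ≡ rename s (lookup ρ) y
  tuple≡ᵈ (vec zero) [] [] = ⇔ᵈ (λ 𝔄 ρ → mk⇔ (λ _ → refl) _) ⊤ᵈ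
  tuple≡ᵈ (vec (suc k)) (x ∷ xs) (y ∷ ys) =
    ⇔ᵈ (λ 𝔄 ρ → mk⇔ (λ { (p , q) → cong₂ _∷_ p q }) (λ e → Vecₚ.∷-injective e))
       (≐ᵈ x y ×ᵈ tuple≡ᵈ (vec k) xs ys)
  tuple≡ᵈ (s ⊗ t) (x , x′) (y , y′) =
    ⇔ᵈ (λ 𝔄 ρ → mk⇔ (λ { (p , q) → cong₂ _,_ p q }) (λ e → cong proj₁ e , cong proj₂ e))
       (tuple≡ᵈ s x y ×ᵈ tuple≡ᵈ t x′ y′)

  decide : ∀ {m} (φ : FO-HornRes σ m) → IsFirstOrder φ → ∀ 𝔄 ρ → Dec (𝔄 ⊨ᴴ φ [ ρ ])
  decide (atom R ts) fo 𝔄 ρ = T? _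
  decide (s ≐ t) fo 𝔄 ρ = lookup ρ s ≟ lookup ρ t
  decide (¬′ φ) fo 𝔄 ρ = ¬? (decide φ fo 𝔄 ρ)
  decide (φ ∧′ ψ) fo 𝔄 ρ =
    decide φ (ℕₚ.m+n≡0⇒m≡0 _ fo) 𝔄 ρ ×-dec decide ψ (ℕₚ.m+n≡0⇒n≡0 (#𝒬 φ) fo) 𝔄 ρ
  decide (φ ∨′ ψ) fo 𝔄 ρ =
    decide φ (ℕₚ.m+n≡0⇒m≡0 _ fo) 𝔄 ρ ⊎-dec decide ψ (ℕₚ.m+n≡0⇒n≡0 (#𝒬 φ) fo) 𝔄 ρ
  decide (∃′ φ) fo 𝔄 ρ = any? λ x → decide φ fo 𝔄 (x ∷ ρ)
  decide (∀′ φ) fo 𝔄 ρ = all? λ x → decide φ fo 𝔄 (x ∷ ρ)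

  definable? : ∀ {m} {R : Predicate σ m} → Definable R → ∀ 𝔄 ρ → Dec (R 𝔄 ρ)
  definable? (definable φ fo d) 𝔄 ρ = map′ (to (d 𝔄 ρ)) (from (d 𝔄 ρ)) (decide φ fo 𝔄 ρ)

-- Alternating systems of rules

-- Every node carries two predicates, one for each sign.
data Code : Set where
  ∅    : Code
  node : Shape → Code → Code → Code

data Tag : Code → Shape → Set where
  this  : ∀ {s c d} → Sign → Tag (node s c d) s
  left  : ∀ {s c d t} → Tag c t → Tag (node s c d) t
  right : ∀ {s c d t} → Tag d t → Tag (node s c d) t

-- Naturality says that entries are merely moved, copied or dropped. One function then acts on
-- variables and on elements alike, which makes the edges of the rule graph first-order definable.
record Rearrangement (j : ℕ) (s t : Shape) : Set where
  constructor rearrangement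
  field
    apply   : ∀ {n} → Vec (Fin n) j → Tuple s n → Tuple t n
    natural : ∀ {m n} (f : Fin m → Fin n) z x →
              rename t f (apply z x) ≡ apply (map f z) (rename s f x)

record Guard (σ : Vocabulary) (s : Shape) : Set₁ where
  constructor mkGuard
  field
    Passes  : (𝔄 : Structure σ) → Tuple s (size 𝔄) → Set
    passesᵈ : ∀ {m} (x : Tuple s m) → Definable λ 𝔄 ρ → Passes 𝔄 (rename s (lookup ρ) x)

record Call (𝕋 : Shape → Set) (s : Shape) : Set where
  constructor _$_
  field
    {#fresh} : ℕ
    {shape}  : Shape
    target   : 𝕋 shape
    args     : Rearrangement #fresh s shape

-- The junctor pos stands for a conjunction over all calls and values of the
-- fresh variables, neg for a disjunction.
record Rule (σ : Vocabulary) (𝕋 : Shape → Set) (s : Shape) : Set₁ where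
  constructor mkRule
  field
    junctor  : Sign
    guard    : Guard σ s
    {#calls} : ℕ
    calls    : Fin #calls → Call 𝕋 s

open Rearrangement
open Guard
open Call
open Rule

Valuation : (Shape → Set) → ℕ → Set₁
Valuation 𝕋 n = ∀ {s} → 𝕋 s → Tuple s n → Set

module _ {𝕋 : Shape → Set} {s : Shape} {q : ℕ} where

  Fires : Sign → (Fin q → Call 𝕋 s) → ∀ {n} → Valuation 𝕋 n → Tuple s n → Set
  Fires pos cs K x = ∀ i z → K (target (cs i)) (apply (args (cs i)) z x)
  Fires neg cs K x = ∃₂ λ i z → K (target (cs i)) (apply (args (cs i)) z x)

Holds : ∀ {σ 𝕋 s} → Rule σ 𝕋 s → (𝔄 : Structure σ) → Valuation 𝕋 (size 𝔄) → Tuple s (size 𝔄) → Set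
Holds r 𝔄 K x = Passes (guard r) 𝔄 x × Fires (junctor r) (calls r) K x

_∘ᴳ_ : ∀ {σ s t} → Guard σ t → Rearrangement 0 s t → Guard σ s
_∘ᴳ_ {s = s} {t} G f = mkGuard (λ 𝔄 x → Passes G 𝔄 (apply f [] x)) λ x →
  ⇔ᵈ (λ 𝔄 ρ → ≡⇒⇔ (cong (Passes G 𝔄) (natural f (lookup ρ) [] x))) (passesᵈ G (apply f [] x))

_∘ᴿ_ : ∀ {j s t u} → Rearrangement j t u → Rearrangement 0 s t → Rearrangement j s u
g ∘ᴿ f = rearrangement (λ z x → apply g z (apply f [] x)) λ h z x →
  trans (natural g h z _) (cong (apply g (map h z)) (natural f h [] x))

_∘ʳ_ : ∀ {σ 𝕋 s t} → Rule σ 𝕋 t → Rearrangement 0 s t → Rule σ 𝕋 s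
mkRule jn G cs ∘ʳ f = mkRule jn (G ∘ᴳ f) λ i → target (cs i) $ (args (cs i) ∘ᴿ f)

holds-∘ʳ : ∀ {σ 𝕋 s t} (r : Rule σ 𝕋 t) (f : Rearrangement 0 s t) 𝔄 (K : Valuation 𝕋 (size 𝔄)) x →
           Holds (r ∘ʳ f) 𝔄 K x ⇔ Holds r 𝔄 K (apply f [] x)
holds-∘ʳ (mkRule pos G cs) f 𝔄 K x = mk⇔ id id
holds-∘ʳ (mkRule neg G cs) f 𝔄 K x = mk⇔ id id

identity : ∀ {s} → Rearrangement 0 s s
identity = rearrangement (λ _ x → x) λ f z x → refl

trueᴳ : ∀ {σ s} → Guard σ s
trueᴳ = mkGuard (λ _ _ → ⊤) λ _ → ⊤ᵈ

equalᴳ : ∀ {σ} → Sign → Guard σ (vec 2)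
equalᴳ s = mkGuard (λ { 𝔄 (f ∷ g ∷ []) → Signed s (f ≡ g) }) λ { (f ∷ g ∷ []) → signedᵈ s (≐ᵈ f g) }

relationᴳ : ∀ {σ} (R : Symbol σ) → Sign → Guard σ (vec (arity σ R) ⊗ vec 0)
relationᴳ R s = mkGuard (λ { 𝔄 (z , _) → Signed s (holds 𝔄 R z) }) λ { (z , _) → signedᵈ s (atomᵈ R z) }

-- A conjunction of no calls always fires, so the guard alone decides.
literal : ∀ {σ 𝕋 s} → Guard σ s → Rule σ 𝕋 s
literal G = mkRule pos G {0} λ ()

_over_ : ∀ {σ 𝕋 s q} → Sign → Vec (Call 𝕋 s) q → Rule σ 𝕋 s
jn over cs = mkRule jn trueᴳ (lookup cs)

-- Translation of formulas into rules

map-lookup-map : ∀ {m n k r} (f : Fin m → Fin n) (ts : Vec (Fin k) r) (a : Vec (Fin m) k) →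
                 map f (map (lookup a) ts) ≡ map (lookup (map f a)) ts
map-lookup-map f ts a = trans (sym (Vecₚ.map-∘ f (lookup a) ts))
  (Vecₚ.map-cong (λ i → sym (Vecₚ.lookup-map i f a)) ts)

-- The values of the variables that are fixed while a fixed-point body is
-- evaluated: a cut, the parameters, and those of the enclosing fixed points.
-- A cut (f , g , y) stands for the empty stage if f ≡ g, and otherwise for
-- the first stage containing y.
Hidden : (r k : ℕ) → Shape → Shape
Hidden r k η = (vec 2 ⊗ vec r) ⊗ (vec k ⊗ η)

-- The case distinction is left to `codeˡ` and `codeʳ`, so that `code φ η` reduces to a `node` for
-- an arbitrary `φ` and its root tags `this s` are always available.
code  : ∀ {σ k} → LFP σ k → Shape → Code
codeˡ : ∀ {σ k} → LFP σ k → Shape → Code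
codeʳ : ∀ {σ k} → LFP σ k → Shape → Code

code {k = k} φ η = node (vec k ⊗ η) (codeˡ φ η) (codeʳ φ η)

codeˡ (atom R ts) η = ∅
codeˡ (s ≐ t) η     = ∅
codeˡ (¬′ φ) η      = code φ η
codeˡ (φ ∧′ ψ) η    = code φ η
codeˡ (φ ∨′ ψ) η    = code φ η
codeˡ (∃′ φ) η      = code φ η
codeˡ (∀′ φ) η      = code φ η
codeˡ {k = k} (lfp {r} ψ p ts) η =
  node (vec r ⊗ Hidden r k η)
    (node ((vec 2 ⊗ vec r) ⊗ (vec r ⊗ Hidden r k η)) (node (vec 2) ∅ ∅) ∅)
    (node (vec r ⊗ Hidden r k η) ∅ ∅)

codeʳ (φ ∧′ ψ) η = code ψ η
codeʳ (φ ∨′ ψ) η = code ψ η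
codeʳ {k = k} (lfp {r} ψ p ts) η = code ψ (Hidden r k η)
codeʳ _ η = ∅

-- stage± (z , cut): z belongs, resp. does not belong, to the stage given by the cut.
pattern stageᵗ s  = left (this s)
pattern stepᵗ s   = left (left (this s))
pattern equalᵗ s  = left (left (left (this s)))
-- limit⁺ (z , cut): z does not belong to the stage, and the stage is closed.
-- limit⁻ (u , cut): u belongs to the stage or not to the next one.
pattern limit⁺ᵗ   = left (right (this pos))
pattern limit⁻ᵗ   = left (right (this neg))

module _ {η : Shape} where

  select : ∀ {k r} → Vec (Fin k) r → Rearrangement 0 (vec k ⊗ η) (vec r ⊗ η)
  select ts = rearrangement (λ { _ (a , h) → map (lookup a) ts , h })
    λ { f z (a , h) → cong (_, rename η f h) (map-lookup-map f ts a) }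

  extend : ∀ {k} → Rearrangement 1 (vec k ⊗ η) (vec (suc k) ⊗ η)
  extend = rearrangement (λ { (x ∷ []) (a , h) → x ∷ a , h }) λ { f (x ∷ []) (a , h) → refl }

  replace : ∀ {r} → Rearrangement r (vec r ⊗ η) (vec r ⊗ η)
  replace = rearrangement (λ { u (z , h) → u , h }) λ { f u (z , h) → refl }

  guess : ∀ {r} → Rearrangement (2 + r) η ((vec 2 ⊗ vec r) ⊗ η)
  guess = rearrangement (λ { (f ∷ g ∷ y) h → (f ∷ g ∷ [] , y) , h }) λ { _ (f ∷ g ∷ y) h → refl }

module _ {r k : ℕ} {η : Shape} where

  enter : Vec (Fin k) r → Rearrangement (2 + r) (vec k ⊗ η) (vec r ⊗ Hidden r k η)
  enter ts = rearrangement
    (λ { (f ∷ g ∷ y) (a , h) → map (lookup a) ts , (f ∷ g ∷ [] , y) , a , h })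
    λ { e (f ∷ g ∷ y) (a , h) → cong (_, (map e (f ∷ g ∷ []) , map e y) , map e a , rename η e h)
                                       (map-lookup-map e ts a) }

  leave : ∀ {s} → Rearrangement 0 (vec s ⊗ Hidden r k η) (vec s ⊗ η)
  leave = rearrangement (λ { _ (z , _ , _ , h) → z , h }) λ { _ _ (z , _ , _ , h) → refl }

  bits : ∀ {s} → Rearrangement 0 (s ⊗ Hidden r k η) (vec 2)
  bits = rearrangement (λ { _ (_ , (fg , _) , _) → fg }) λ { _ _ (_ , (fg , _) , _) → refl }

  instantiate : Rearrangement 0 (vec r ⊗ Hidden r k η) (vec (r + k) ⊗ Hidden r k η)
  instantiate = rearrangement (λ { _ (z , c , a , h) → z ++ a , c , a , h })
    λ { f _ (z , c , a , h) → cong (_, rename (Hidden r k η) f (c , a , h)) (Vecₚ.map-++ f z a) }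

  previous : Rearrangement 0 ((vec 2 ⊗ vec r) ⊗ (vec r ⊗ Hidden r k η)) (vec r ⊗ Hidden r k η)
  previous = rearrangement (λ { _ (c , z , (fg , y) , ah) → y , c , ah })
    λ { _ _ (c , z , (fg , y) , ah) → refl }

  current : Rearrangement 0 ((vec 2 ⊗ vec r) ⊗ (vec r ⊗ Hidden r k η)) (vec r ⊗ Hidden r k η)
  current = rearrangement (λ { _ (c , z , (fg , y) , ah) → z , c , ah })
    λ { _ _ (c , z , (fg , y) , ah) → refl }

  stepBits : Rearrangement 0 ((vec 2 ⊗ vec r) ⊗ (vec r ⊗ Hidden r k η)) (vec 2)
  stepBits = rearrangement (λ { _ (c , z , (fg , y) , ah) → fg })
    λ { _ _ (c , z , (fg , y) , ah) → refl }

-- The sign selects the rule for membership or for non-membership.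
Scope : (σ : Vocabulary) → (Shape → Set) → Vocabulary → Shape → Set₁
Scope σ 𝕋 σ′ η = (R : Symbol σ′) → Sign → Rule σ 𝕋 (vec (arity σ′ R) ⊗ η)

-- An atom of the new fixed-point variable queries the stage of the innermost cut. An outer symbol
-- keeps its rule, read on the hidden values outside that cut, where the cut of its own fixed point
-- is still stored.
bind : ∀ {σ 𝕋 σ′ r k η} → (Sign → 𝕋 (vec r ⊗ Hidden r k η)) → Scope σ 𝕋 σ′ η →
       Scope σ 𝕋 (r ∷ σ′) (Hidden r k η)
bind X sc zero    s = pos over ((X s $ identity) ∷ [])
bind X sc (suc R) s = sc R s ∘ʳ leave

rules : ∀ {σ 𝕋 σ′ k} (φ : LFP σ′ k) η → Scope σ 𝕋 σ′ η → (∀ {s} → Tag (code φ η) s → 𝕋 s) →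
        ∀ {s} → Tag (code φ η) s → Rule σ 𝕋 s
rules (atom R ts) η sc ι (this s) = sc R s ∘ʳ select ts
rules (t ≐ u) η sc ι (this s) = literal (equalᴳ s ∘ᴳ rearrangement (λ { _ (a , _) → lookup a t ∷ lookup a u ∷ [] })
  λ { f _ (a , _) → sym (cong₂ (λ x y → x ∷ y ∷ []) (Vecₚ.lookup-map t f a) (Vecₚ.lookup-map u f a)) })
rules (¬′ φ) η sc ι (this s)   = pos over ((ι (left (this (opposite s))) $ identity) ∷ [])
-- De Morgan: refuting a conjunction is a disjunction of refutations, so the sign itself is the
-- junctor here and for `∀′`, and its opposite for `∨′` and `∃′`.
rules (φ ∧′ ψ) η sc ι (this s) =
  s over ((ι (left (this s)) $ identity) ∷ (ι (right (this s)) $ identity) ∷ [])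
rules (φ ∨′ ψ) η sc ι (this s) =
  opposite s over ((ι (left (this s)) $ identity) ∷ (ι (right (this s)) $ identity) ∷ [])
rules (∃′ φ) η sc ι (this s)   = opposite s over ((ι (left (this s)) $ extend) ∷ [])
rules (∀′ φ) η sc ι (this s)   = s over ((ι (left (this s)) $ extend) ∷ [])
rules (lfp ψ p ts) η sc ι (this pos) = neg over ((ι (stageᵗ pos) $ enter ts) ∷ [])
rules (lfp ψ p ts) η sc ι (this neg) = neg over ((ι limit⁺ᵗ $ enter ts) ∷ [])
rules (lfp ψ p ts) η sc ι (stageᵗ pos) = neg over ((ι (stepᵗ pos) $ guess) ∷ [])
-- Everything lies outside the empty stage, hence the second alternative; nothing lies inside it, so
-- the positive rule has no counterpart.
rules (lfp ψ p ts) η sc ι (stageᵗ neg) =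
  neg over ((ι (stepᵗ neg) $ guess) ∷ (ι (equalᵗ pos) $ bits) ∷ [])
rules (lfp ψ p ts) η sc ι (stepᵗ s) =
  pos over ( (ι (equalᵗ neg) $ stepBits)
            ∷ (ι (stageᵗ neg) $ previous)
            ∷ (ι (right (this pos)) $ (instantiate ∘ᴿ previous))
            ∷ (ι (right (this s)) $ (instantiate ∘ᴿ current))
            ∷ [])
rules (lfp ψ p ts) η sc ι (equalᵗ s) = literal (equalᴳ s)
rules (lfp ψ p ts) η sc ι limit⁺ᵗ = pos over ((ι (stageᵗ neg) $ identity) ∷ (ι limit⁻ᵗ $ replace) ∷ [])
rules (lfp ψ p ts) η sc ι limit⁻ᵗ =
  neg over ((ι (stageᵗ pos) $ identity) ∷ (ι (right (this neg)) $ instantiate) ∷ [])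
rules (¬′ φ) η sc ι (left t) = rules φ η sc (ι ∘ left) t
rules (φ ∧′ ψ) η sc ι (left t) = rules φ η sc (ι ∘ left) t
rules (φ ∧′ ψ) η sc ι (right t) = rules ψ η sc (ι ∘ right) t
rules (φ ∨′ ψ) η sc ι (left t) = rules φ η sc (ι ∘ left) t
rules (φ ∨′ ψ) η sc ι (right t) = rules ψ η sc (ι ∘ right) t
rules (∃′ φ) η sc ι (left t) = rules φ η sc (ι ∘ left) t
rules (∀′ φ) η sc ι (left t) = rules φ η sc (ι ∘ left) t
rules {k = k} (lfp {r} ψ p ts) η sc ι (right t) =
  rules ψ (Hidden r k η) (bind (λ s → ι (stageᵗ s)) sc) (ι ∘ right) t

baseScope : ∀ {σ 𝕋} → Scope σ 𝕋 σ (vec 0)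
baseScope R s = literal (relationᴳ R s)

-- Soundness of the rules

module Soundness {σ : Vocabulary} (𝔄 : Structure σ) where

  open LFP-Semantics (nonEmpty 𝔄)

  private
    n : ℕ
    n = size 𝔄

  -- Compatible h A: the relations A are those that the hidden values h stand
  -- for.  Nothing is claimed about hidden values that stand for no relations.
  Compatibility : Vocabulary → Shape → Set₁
  Compatibility σ′ η = Tuple η n → Relations σ′ n → Set

  module Meanings {σ′ k r} (ψ : LFP (r ∷ σ′) (r + k)) (p : PositiveIn zero ψ)
                  (η : Shape) (C : Compatibility σ′ η) where

    IsCut : Tuple (vec 2 ⊗ vec r) n → Relations σ′ n → Vec (Fin n) k → ℕ → Set
    IsCut (f ∷ g ∷ [] , y) A a zero    = f ≡ g
    IsCut (f ∷ g ∷ [] , y) A a (suc i) = f ≢ g × New i y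
      where open LFP-Stages ψ p A a

    Equal : Sign → Vec (Fin n) 2 → Set
    Equal s (f ∷ g ∷ []) = Signed s (f ≡ g)

    -- That the cut names a stage is part of the assertion. A derivation about a guessed cut thus
    -- also certifies the guess, for whichever compatible relations the outer hidden values stand
    -- for.
    InStage : Sign → Tuple (vec r ⊗ Hidden r k η) n → Set
    InStage s (z , c , a , h) = ∀ A → C h A → let open LFP-Stages ψ p A a in
      ∃ λ i → IsCut c A a i × Signed s (T (stage i z))

    -- The innermost relation is bound only by what is asserted about the cut. This makes the rule
    -- of `bind` for the fixed-point variable sound by definition, and `stage-compatible` shows that
    -- the stage named by a genuine cut qualifies.
    C′ : Compatibility (r ∷ σ′) (Hidden r k η)
    C′ (c , a , h) A = C h (tail A) × (∀ s z → InStage s (z , c , a , h) → Signed s (T ((A at zero) z)))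

    Body : Sign → Tuple (vec (r + k) ⊗ Hidden r k η) n → Set
    Body s (za , h) = ∀ A → C′ h A → Signed s (⟨ A ⟩ ⊨ᴸ ψ [ za ])

    Step : Sign → Tuple ((vec 2 ⊗ vec r) ⊗ (vec r ⊗ Hidden r k η)) n → Set
    Step s x = Equal neg (apply stepBits [] x)
             × InStage neg (apply previous [] x)
             × Body pos (apply instantiate [] (apply previous [] x))
             × Body s (apply instantiate [] (apply current [] x))

    Limit⁻ : Tuple (vec r ⊗ Hidden r k η) n → Set
    Limit⁻ x = InStage pos x ⊎ Body neg (apply instantiate [] x)

    Limit⁺ : Tuple (vec r ⊗ Hidden r k η) n → Set
    Limit⁺ (z , h) = InStage neg (z , h) × (∀ u → Limit⁻ (u , h))

    -- A tuple enters an increasing sequence of stages only once.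
    cut-unique : ∀ c A a i j → IsCut c A a i → IsCut c A a j → i ≡ j
    cut-unique c A a zero    zero    p q = refl
    cut-unique (f ∷ g ∷ [] , y) A a zero    (suc j) p (q , _) = contradiction p q
    cut-unique (f ∷ g ∷ [] , y) A a (suc i) zero    (p , _) q = contradiction q p
    cut-unique (f ∷ g ∷ [] , y) A a (suc i) (suc j) (_ , y∈ , y∉) (_ , y∈′ , y∉′)
      with ℕₚ.<-cmp i j
    ... | tri< i<j _ _ = contradiction (stage-mono i<j y y∈) y∉′
      where open LFP-Stages ψ p A a
    ... | tri≈ _ refl _ = refl
    ... | tri> _ _ j<i = contradiction (stage-mono j<i y y∈′) y∉
      where open LFP-Stages ψ p A a

    stage-compatible : ∀ {c a h A} → C h A → ∀ i → IsCut c A a i →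
                       C′ (c , a , h) (A ▹ LFP-Stages.stage ψ p A a i)
    stage-compatible {c} {a} {h} {A} hA i cut = hA , λ s z In →
      let j , cut′ , q = In A hA in
      subst (λ i → Signed s (T (LFP-Stages.stage ψ p A a i z))) (cut-unique c A a j i cut′ cut) q

    -- The premises on `y` keep it out of the guessed stage `i` and put it into the next one, so the
    -- cut names stage `suc i`; the body at stage `i` then decides about `z`.
    stage-step : ∀ s x → Step s x → InStage s (proj₂ x)
    stage-step s (c , z , (f ∷ g ∷ [] , y) , a , h) (f≢g , y∉ , ψy , ψz) A hA =
      suc i , (f≢g , stage-suc⁺ i y (ψy _ compatible) , ¬y)
            , signed-map s (mk⇔ (stage-suc⁺ i z) (stage-suc⁻ i z)) (ψz _ compatible)
      where
      open LFP-Stages ψ p A a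
      i = proj₁ (y∉ A hA)
      cut = proj₁ (proj₂ (y∉ A hA))
      ¬y = proj₂ (proj₂ (y∉ A hA))
      compatible = stage-compatible hA i cut

    -- Closedness makes the stage of the cut prefixed, hence an upper bound of all stages, and `z`
    -- lies outside it.
    limit-sound : ∀ {z c a h} → Limit⁺ (z , c , a , h) → ∀ A → C h A →
                  ∀ i → ¬ T (LFP-Stages.stage ψ p A a i z)
    limit-sound {z} {c} {a} {h} (z∉ , closed) A hA j z∈ =
      ¬z (stage-⊆-prefixed pre j z z∈)
      where
      open LFP-Stages ψ p A a
      i = proj₁ (z∉ A hA)
      cut = proj₁ (proj₂ (z∉ A hA))
      ¬z = proj₂ (proj₂ (z∉ A hA))
      pre : ∀ u → Operator ψ A a (stage i) u → T (stage i u)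
      pre u ψu with closed u
      ... | inj₁ u∈ = proj₂ (stage-compatible hA i cut) pos u u∈
      ... | inj₂ ¬ψu = contradiction ψu (¬ψu _ (stage-compatible hA i cut))

  Meaning : ∀ {σ′ k} (φ : LFP σ′ k) η → Compatibility σ′ η → Valuation (Tag (code φ η)) n
  Meaning φ η C (this s) (a , h) = ∀ A → C h A → Signed s (⟨ A ⟩ ⊨ᴸ φ [ a ])
  Meaning (¬′ φ) η C (left t)    = Meaning φ η C t
  Meaning (φ ∧′ ψ) η C (left t)  = Meaning φ η C t
  Meaning (φ ∧′ ψ) η C (right t) = Meaning ψ η C t
  Meaning (φ ∨′ ψ) η C (left t)  = Meaning φ η C t
  Meaning (φ ∨′ ψ) η C (right t) = Meaning ψ η C t
  Meaning (∃′ φ) η C (left t)    = Meaning φ η C t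
  Meaning (∀′ φ) η C (left t)    = Meaning φ η C t
  Meaning (lfp ψ p ts) η C (stageᵗ s) = Meanings.InStage ψ p η C s
  Meaning (lfp ψ p ts) η C (stepᵗ s)  = Meanings.Step ψ p η C s
  Meaning (lfp ψ p ts) η C (equalᵗ s) = Meanings.Equal ψ p η C s
  Meaning (lfp ψ p ts) η C limit⁺ᵗ    = Meanings.Limit⁺ ψ p η C
  Meaning (lfp ψ p ts) η C limit⁻ᵗ    = Meanings.Limit⁻ ψ p η C
  Meaning (lfp {r} ψ p ts) η C (right t) = Meaning ψ _ (Meanings.C′ ψ p η C) t

  ScopeSound : ∀ {𝕋 σ′ η} → Scope σ 𝕋 σ′ η → Valuation 𝕋 n → Compatibility σ′ η → Set
  ScopeSound sc 𝕄 C = ∀ R s z h → Holds (sc R s) 𝔄 𝕄 (z , h) →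
                      ∀ A → C h A → Signed s (T ((A at R) z))

  -- Rules of a subformula call into the surrounding system `𝕋`, through `ι` and through the scope.
  -- The induction therefore keeps one valuation `𝕄` of all of `𝕋`, which on the tags of the
  -- subformula has to imply `Meaning`.
  meaning-closed : ∀ {𝕋 σ′ k} (φ : LFP σ′ k) η C (sc : Scope σ 𝕋 σ′ η)
                   (ι : ∀ {s} → Tag (code φ η) s → 𝕋 s) (𝕄 : Valuation 𝕋 n) →
                   (∀ {s} (t : Tag (code φ η) s) x → 𝕄 (ι t) x → Meaning φ η C t x) →
                   ScopeSound sc 𝕄 C →
                   ∀ {s} (t : Tag (code φ η) s) x → Holds (rules φ η sc ι t) 𝔄 𝕄 x → Meaning φ η C t x
  meaning-closed (atom R ts) η C sc ι 𝕄 𝕄⊆ scS (this s) (a , h) hyp =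
    scS R s _ h (to (holds-∘ʳ (sc R s) (select ts) 𝔄 𝕄 (a , h)) hyp)
  meaning-closed (t ≐ u) η C sc ι 𝕄 𝕄⊆ scS (this s) (a , h) (g , _) A hA = g
  meaning-closed (¬′ φ) η C sc ι 𝕄 𝕄⊆ scS (this pos) (a , h) (_ , m) =
    𝕄⊆ (left (this neg)) _ (m zero [])
  meaning-closed (¬′ φ) η C sc ι 𝕄 𝕄⊆ scS (this neg) (a , h) (_ , m) A hA ¬p =
    ¬p (𝕄⊆ (left (this pos)) _ (m zero []) A hA)
  meaning-closed (φ ∧′ ψ) η C sc ι 𝕄 𝕄⊆ scS (this pos) x (_ , m) A hA =
    𝕄⊆ (left (this pos)) _ (m zero []) A hA , 𝕄⊆ (right (this pos)) _ (m (suc zero) []) A hA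
  meaning-closed (φ ∧′ ψ) η C sc ι 𝕄 𝕄⊆ scS (this neg) x (_ , zero , [] , m) A hA (p , q) =
    𝕄⊆ (left (this neg)) _ m A hA p
  meaning-closed (φ ∧′ ψ) η C sc ι 𝕄 𝕄⊆ scS (this neg) x (_ , suc zero , [] , m) A hA (p , q) =
    𝕄⊆ (right (this neg)) _ m A hA q
  meaning-closed (φ ∨′ ψ) η C sc ι 𝕄 𝕄⊆ scS (this pos) x (_ , zero , [] , m) A hA =
    inj₁ (𝕄⊆ (left (this pos)) _ m A hA)
  meaning-closed (φ ∨′ ψ) η C sc ι 𝕄 𝕄⊆ scS (this pos) x (_ , suc zero , [] , m) A hA =
    inj₂ (𝕄⊆ (right (this pos)) _ m A hA)
  meaning-closed (φ ∨′ ψ) η C sc ι 𝕄 𝕄⊆ scS (this neg) x (_ , m) A hA =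
    [ 𝕄⊆ (left (this neg)) _ (m zero []) A hA , 𝕄⊆ (right (this neg)) _ (m (suc zero) []) A hA ]′
  meaning-closed (∃′ φ) η C sc ι 𝕄 𝕄⊆ scS (this pos) x (_ , zero , y ∷ [] , m) A hA =
    y , 𝕄⊆ (left (this pos)) _ m A hA
  meaning-closed (∃′ φ) η C sc ι 𝕄 𝕄⊆ scS (this neg) x (_ , m) A hA (y , p) =
    𝕄⊆ (left (this neg)) _ (m zero (y ∷ [])) A hA p
  meaning-closed (∀′ φ) η C sc ι 𝕄 𝕄⊆ scS (this pos) x (_ , m) A hA y =
    𝕄⊆ (left (this pos)) _ (m zero (y ∷ [])) A hA
  meaning-closed (∀′ φ) η C sc ι 𝕄 𝕄⊆ scS (this neg) x (_ , zero , y ∷ [] , m) A hA p =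
    𝕄⊆ (left (this neg)) _ m A hA (p y)
  meaning-closed (lfp ψ p ts) η C sc ι 𝕄 𝕄⊆ scS (this pos) (a , h) (_ , zero , f ∷ g ∷ y , m) A hA =
    let i , _ , t = 𝕄⊆ (stageᵗ pos) _ m A hA in from (lfp⇔stage (map (lookup a) ts)) (i , t)
    where open LFP-Stages ψ p A a
  meaning-closed (lfp ψ p ts) η C sc ι 𝕄 𝕄⊆ scS (this neg) (a , h) (_ , zero , f ∷ g ∷ y , m) A hA l =
    let i , t = to (lfp⇔stage (map (lookup a) ts)) l in
    Meanings.limit-sound ψ p η C (𝕄⊆ limit⁺ᵗ _ m) A hA i t
    where open LFP-Stages ψ p A a
  meaning-closed (lfp ψ p ts) η C sc ι 𝕄 𝕄⊆ scS (stageᵗ pos) x (_ , zero , f ∷ g ∷ y , m) =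
    Meanings.stage-step ψ p η C pos _ (𝕄⊆ (stepᵗ pos) _ m)
  meaning-closed (lfp ψ p ts) η C sc ι 𝕄 𝕄⊆ scS (stageᵗ neg) x (_ , zero , f ∷ g ∷ y , m) =
    Meanings.stage-step ψ p η C neg _ (𝕄⊆ (stepᵗ neg) _ m)
  meaning-closed (lfp ψ p ts) η C sc ι 𝕄 𝕄⊆ scS (stageᵗ neg) (z , (f ∷ g ∷ [] , y) , a , h)
    (_ , suc zero , [] , m) A hA = zero , 𝕄⊆ (equalᵗ pos) (f ∷ g ∷ []) m , λ ()
  meaning-closed (lfp ψ p ts) η C sc ι 𝕄 𝕄⊆ scS (stepᵗ s) x (_ , m) =
    𝕄⊆ (equalᵗ neg) _ (m zero []) , 𝕄⊆ (stageᵗ neg) _ (m (suc zero) []) ,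
    𝕄⊆ (right (this pos)) _ (m (suc (suc zero)) []) ,
    𝕄⊆ (right (this s)) _ (m (suc (suc (suc zero))) [])
  meaning-closed (lfp ψ p ts) η C sc ι 𝕄 𝕄⊆ scS (equalᵗ s) (f ∷ g ∷ []) (e , _) = e
  meaning-closed (lfp ψ p ts) η C sc ι 𝕄 𝕄⊆ scS limit⁺ᵗ x (_ , m) =
    𝕄⊆ (stageᵗ neg) _ (m zero []) , λ u → 𝕄⊆ limit⁻ᵗ _ (m (suc zero) u)
  meaning-closed (lfp ψ p ts) η C sc ι 𝕄 𝕄⊆ scS limit⁻ᵗ x (_ , zero , [] , m) =
    inj₁ (𝕄⊆ (stageᵗ pos) _ m)
  meaning-closed (lfp ψ p ts) η C sc ι 𝕄 𝕄⊆ scS limit⁻ᵗ x (_ , suc zero , [] , m) =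
    inj₂ (𝕄⊆ (right (this neg)) _ m)
  meaning-closed (¬′ φ) η C sc ι 𝕄 𝕄⊆ scS (left t) =
    meaning-closed φ η C sc (ι ∘ left) 𝕄 (𝕄⊆ ∘ left) scS t
  meaning-closed (φ ∧′ ψ) η C sc ι 𝕄 𝕄⊆ scS (left t) =
    meaning-closed φ η C sc (ι ∘ left) 𝕄 (𝕄⊆ ∘ left) scS t
  meaning-closed (φ ∧′ ψ) η C sc ι 𝕄 𝕄⊆ scS (right t) =
    meaning-closed ψ η C sc (ι ∘ right) 𝕄 (𝕄⊆ ∘ right) scS t
  meaning-closed (φ ∨′ ψ) η C sc ι 𝕄 𝕄⊆ scS (left t) =
    meaning-closed φ η C sc (ι ∘ left) 𝕄 (𝕄⊆ ∘ left) scS t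
  meaning-closed (φ ∨′ ψ) η C sc ι 𝕄 𝕄⊆ scS (right t) =
    meaning-closed ψ η C sc (ι ∘ right) 𝕄 (𝕄⊆ ∘ right) scS t
  meaning-closed (∃′ φ) η C sc ι 𝕄 𝕄⊆ scS (left t) =
    meaning-closed φ η C sc (ι ∘ left) 𝕄 (𝕄⊆ ∘ left) scS t
  meaning-closed (∀′ φ) η C sc ι 𝕄 𝕄⊆ scS (left t) =
    meaning-closed φ η C sc (ι ∘ left) 𝕄 (𝕄⊆ ∘ left) scS t
  meaning-closed (lfp ψ p ts) η C sc ι 𝕄 𝕄⊆ scS (right t) =
    meaning-closed ψ _ (Meanings.C′ ψ p η C) _ (ι ∘ right) 𝕄 (𝕄⊆ ∘ right) scS′ t
    where
    scS′ : ScopeSound (bind (λ s → ι (stageᵗ s)) sc) 𝕄 (Meanings.C′ ψ p η C)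
    scS′ zero s z h (_ , m) A (_ , zeroOK) = zeroOK s z (𝕄⊆ (stageᵗ s) _ (m zero []))
    scS′ (suc R) s z (_ , _ , h) hyp A (hA , _) =
      scS R s z h (to (holds-∘ʳ (sc R s) leave 𝔄 𝕄 _) hyp) (tail A) hA

-- Completeness of the rules

module Completeness {σ : Vocabulary} (𝔄 : Structure σ) {x₀ x₁ : Element 𝔄} (x₀≢x₁ : x₀ ≢ x₁) where

  open LFP-Semantics (nonEmpty 𝔄)

  private
    n : ℕ
    n = size 𝔄

  ScopeComplete : ∀ {𝕋 σ′ η} → Scope σ 𝕋 σ′ η → Valuation 𝕋 n → Tuple η n → Relations σ′ n → Set
  ScopeComplete sc K h A = ∀ R s z → Signed s (T ((A at R) z)) → Holds (sc R s) 𝔄 K (z , h)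

  -- The hidden values `h` are tied to actual relations `A` whose true literals the scope derives,
  -- so the induction only meets cuts that describe stages.
  complete : ∀ {𝕋 σ′ k} (φ : LFP σ′ k) η (sc : Scope σ 𝕋 σ′ η)
             (ι : ∀ {s} → Tag (code φ η) s → 𝕋 s) (K : Valuation 𝕋 n) →
             (∀ {s} (t : Tag (code φ η) s) x → Holds (rules φ η sc ι t) 𝔄 K x → K (ι t) x) →
             ∀ h A → ScopeComplete sc K h A →
             ∀ s a → Signed s (⟨ A ⟩ ⊨ᴸ φ [ a ]) → K (ι (this s)) (a , h)
  complete (atom R ts) η sc ι K cl h A scC s a p =
    cl (this s) _ (from (holds-∘ʳ (sc R s) (select ts) 𝔄 K (a , h)) (scC R s _ p))
  complete (t ≐ u) η sc ι K cl h A scC s a p = cl (this s) _ (p , λ ())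
  complete (¬′ φ) η sc ι K cl h A scC s a p =
    cl (this s) _ (tt , λ { zero [] → complete φ η sc (ι ∘ left) K (cl ∘ left) h A scC (opposite s) a (dual s p) })
    where
    dual : ∀ s → Signed s (¬ (⟨ A ⟩ ⊨ᴸ φ [ a ])) → Signed (opposite s) (⟨ A ⟩ ⊨ᴸ φ [ a ])
    dual pos ¬p = ¬p
    dual neg ¬¬p with A ⊨? φ [ a ]
    ... | yes p = p
    ... | no ¬p = contradiction ¬p ¬¬p
  complete (φ ∧′ ψ) η sc ι K cl h A scC pos a (p , q) =
    cl (this pos) _ (tt , λ { zero [] → complete φ η sc (ι ∘ left) K (cl ∘ left) h A scC pos a p
                            ; (suc zero) [] → complete ψ η sc (ι ∘ right) K (cl ∘ right) h A scC pos a q })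
  complete (φ ∧′ ψ) η sc ι K cl h A scC neg a ¬pq with A ⊨? φ [ a ]
  ... | no ¬p = cl (this neg) _ (tt , zero , [] , complete φ η sc (ι ∘ left) K (cl ∘ left) h A scC neg a ¬p)
  ... | yes p = cl (this neg) _ (tt , suc zero , [] ,
                  complete ψ η sc (ι ∘ right) K (cl ∘ right) h A scC neg a (λ q → ¬pq (p , q)))
  complete (φ ∨′ ψ) η sc ι K cl h A scC pos a (inj₁ p) =
    cl (this pos) _ (tt , zero , [] , complete φ η sc (ι ∘ left) K (cl ∘ left) h A scC pos a p)
  complete (φ ∨′ ψ) η sc ι K cl h A scC pos a (inj₂ q) =
    cl (this pos) _ (tt , suc zero , [] , complete ψ η sc (ι ∘ right) K (cl ∘ right) h A scC pos a q)
  complete (φ ∨′ ψ) η sc ι K cl h A scC neg a ¬pq =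
    cl (this neg) _ (tt , λ { zero [] → complete φ η sc (ι ∘ left) K (cl ∘ left) h A scC neg a (¬pq ∘ inj₁)
                            ; (suc zero) [] → complete ψ η sc (ι ∘ right) K (cl ∘ right) h A scC neg a (¬pq ∘ inj₂) })
  complete (∃′ φ) η sc ι K cl h A scC pos a (x , p) =
    cl (this pos) _ (tt , zero , x ∷ [] , complete φ η sc (ι ∘ left) K (cl ∘ left) h A scC pos (x ∷ a) p)
  complete (∃′ φ) η sc ι K cl h A scC neg a ¬p =
    cl (this neg) _ (tt , λ { zero (x ∷ []) →
      complete φ η sc (ι ∘ left) K (cl ∘ left) h A scC neg (x ∷ a) (λ p → ¬p (x , p)) })
  complete (∀′ φ) η sc ι K cl h A scC pos a p =
    cl (this pos) _ (tt , λ { zero (x ∷ []) →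
      complete φ η sc (ι ∘ left) K (cl ∘ left) h A scC pos (x ∷ a) (p x) })
  complete (∀′ φ) η sc ι K cl h A scC neg a ¬p with any? (λ x → ¬? (A ⊨? φ [ x ∷ a ]))
  ... | yes (x , ¬q) = cl (this neg) _ (tt , zero , x ∷ [] ,
                         complete φ η sc (ι ∘ left) K (cl ∘ left) h A scC neg (x ∷ a) ¬q)
  ... | no ∄¬p = ⊥-elim (¬p λ x → case A ⊨? φ [ x ∷ a ] of λ where
                   (yes p) → p
                   (no ¬q) → contradiction (x , ¬q) ∄¬p)
  complete {σ′ = σ′} {k} (lfp {r} ψ p ts) η sc ι K cl h A scC s a = whole s
    where
    open LFP-Stages ψ p A a

    Captures : Tuple (vec 2 ⊗ vec r) n → ℕ → Set
    Captures c i = ∀ s z → Signed s (T (stage i z)) → K (ι (stageᵗ s)) (z , c , a , h)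

    body : ∀ {c i} → Captures c i → ∀ s z → Signed s (Operator ψ A a (stage i) z) →
           K (ι (right (this s))) (z ++ a , c , a , h)
    body {c} {i} cap s z =
      complete ψ _ _ (ι ∘ right) K (cl ∘ right) (c , a , h) (A ▹ stage i) scC′ s (z ++ a)
      where
      scC′ : ScopeComplete (bind (λ s → ι (stageᵗ s)) sc) K (c , a , h) (A ▹ stage i)
      scC′ zero    s z q = tt , λ { zero [] → cap s z q }
      scC′ (suc R) s z q = from (holds-∘ʳ (sc R s) leave 𝔄 K _) (scC R s z q)

    -- If stage `suc i` adds nothing, no tuple can name it, but it equals stage `i`, whose cut is
    -- used again.
    captured : ∀ i → ∃ λ c → Captures c i
    captured zero = (x₀ ∷ x₀ ∷ [] , Vec.replicate r x₀) , λ where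
      neg z _ → cl (stageᵗ neg) _ (tt , suc zero , [] , cl (equalᵗ pos) (x₀ ∷ x₀ ∷ []) (refl , λ ()))
    captured (suc i) with captured i | new? i
    ... | c , cap | no ¬new = c , λ s z q →
      cap s z (signed-map s (mk⇔ (stable {i} ¬new z) (stage-⊆-suc i z)) q)
    ... | (f ∷ g ∷ [] , y′) , cap | yes (y , y∈ , y∉) = (x₀ ∷ x₁ ∷ [] , y) , cap′
      where
      step : ∀ s z → Signed s (T (stage (suc i) z)) →
             K (ι (stepᵗ s)) ((f ∷ g ∷ [] , y′) , z , (x₀ ∷ x₁ ∷ [] , y) , a , h)
      step s z q = cl (stepᵗ s) _ (tt , λ where
        zero [] → cl (equalᵗ neg) (x₀ ∷ x₁ ∷ []) (x₀≢x₁ , λ ())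
        (suc zero) [] → cap neg y y∉
        (suc (suc zero)) [] → body {i = i} cap pos y (stage-suc⁻ i y y∈)
        (suc (suc (suc zero))) [] →
          body {i = i} cap s z (signed-map s (mk⇔ (stage-suc⁻ i z) (stage-suc⁺ i z)) q))
      cap′ : Captures (x₀ ∷ x₁ ∷ [] , y) (suc i)
      cap′ pos z q = cl (stageᵗ pos) _ (tt , zero , f ∷ g ∷ y′ , step pos z q)
      cap′ neg z q = cl (stageᵗ neg) _ (tt , zero , f ∷ g ∷ y′ , step neg z q)

    whole : ∀ s → Signed s (⟨ A ⟩ ⊨ᴸ lfp ψ p ts [ a ]) → K (ι (this s)) (a , h)
    whole pos l with to (lfp⇔stage (map (lookup a) ts)) l
    ... | i , t with captured i
    ...   | (f ∷ g ∷ [] , y) , cap = cl (this pos) _ (tt , zero , f ∷ g ∷ y , cap pos _ t)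
    whole neg ¬l with captured N∞
    ... | (f ∷ g ∷ [] , y) , cap = cl (this neg) _ (tt , zero , f ∷ g ∷ y , limit)
      where
      limit⁻ : ∀ u → K (ι limit⁻ᵗ) (u , (f ∷ g ∷ [] , y) , a , h)
      -- The last stage is prefixed, so outside it the body fails.
      limit⁻ u with T? (stage N∞ u)
      ... | yes u∈ = cl limit⁻ᵗ _ (tt , zero , [] , cap pos u u∈)
      ... | no u∉ = cl limit⁻ᵗ _ (tt , suc zero , [] , body {i = N∞} cap neg u (u∉ ∘ prefixed u))
      limit : K (ι limit⁺ᵗ) (map (lookup a) ts , (f ∷ g ∷ [] , y) , a , h)
      limit = cl limit⁺ᵗ _ (tt , λ where
        zero [] → cap neg _ (λ t → ¬l (from (lfp⇔stage (map (lookup a) ts)) (N∞ , t)))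
        (suc zero) u → limit⁻ u)

-- Horn resolution

unit : ∀ {m} → Fin m → Clause m
unit v = clause Sub.⁅ v ⁆ Sub.⊥

-- Truth of a clause with falsity replaced by `G`: a clause without positive literals reads as an
-- implication from its body to `G`, so a refutation proves `G` directly.
Satisfied : ∀ {m} → (Fin m → Set) → Set → Clause m → Set
Satisfied M G c = (∀ v → v Sub.∈ negative c → M v) → (∃ λ v → v Sub.∈ positive c × M v) ⊎ G

resolution-sound : ∀ {m} {Γ : List (Clause m)} (M : Fin m → Set) (G : Set) →
                   (∀ {c} → c ∈ Γ → Satisfied M G c) → ∀ {c} → Γ ⊢ᴴ c → Satisfied M G c
resolution-sound M G ax (axiom c∈Γ) = ax c∈Γ
resolution-sound M G ax (resolve {c} {c′} x d d′ _ _ x∈c x∈c′) neg-true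
  with resolution-sound M G ax d (λ v v∈ → neg-true v (Subₚ.x∈p∪q⁺ (inj₁ v∈)))
... | inj₂ g = inj₂ g
... | inj₁ (v , v∈ , Mv) with v ≟ x
...   | no v≢x = inj₁ (v , Subₚ.x∈p∪q⁺ (inj₁ (Subₚ.x∈p∧x≢y⇒x∈p-y v∈ v≢x)) , Mv)
...   | yes refl = Sum.map₁ (λ { (w , w∈ , Mw) → w , Subₚ.x∈p∪q⁺ {p = positive c Sub.- x} (inj₂ w∈) , Mw })
                     (resolution-sound M G ax d′ neg-true′)
  where
  neg-true′ : ∀ w → w Sub.∈ negative c′ → M w
  neg-true′ w w∈ with w ≟ x
  ... | yes refl = Mv
  ... | no w≢x = neg-true w (Subₚ.x∈p∪q⁺ {p = negative c} (inj₂ (Subₚ.x∈p∧x≢y⇒x∈p-y w∈ w≢x)))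

⁅x⁆-x≡⊥ : ∀ {m} (x : Fin m) → Sub.⁅ x ⁆ Sub.- x ≡ Sub.⊥
⁅x⁆-x≡⊥ x with Subₚ.x∈p⇒p-x⊂p (Subₚ.x∈⁅x⁆ x)
... | sub , z , z∈ , z∉ = Subₚ.Empty-unique λ { (w , w∈) →
  z∉ (subst (Sub._∈ _) (trans (Subₚ.x∈⁅y⁆⇒x≡y x (sub w∈)) (sym (Subₚ.x∈⁅y⁆⇒x≡y x z∈))) w∈) }

resolvent-unit : ∀ {m} (x : Fin m) c → resolvent x (unit x) c ≡ clause (positive c) (negative c Sub.- x)
resolvent-unit x c = cong₂ clause
  (trans (cong (Sub._∪ positive c) (⁅x⁆-x≡⊥ x)) (Subₚ.∪-identityˡ _))
  (Subₚ.∪-identityˡ _)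

isHorn-unit : ∀ {m} (x : Fin m) → IsHornClause (unit x)
isHorn-unit x = ℕₚ.≤-reflexive (Subₚ.∣⁅x⁆∣≡1 x)

-- Resolving with the unit `v` deletes `v` from the body and adds no literal; `k` bounds the number
-- of negative literals still to be removed.
resolve-units : ∀ {m} {Γ : List (Clause m)} k {c} → Sub.∣ negative c ∣ ≤ k → IsHornClause c → Γ ⊢ᴴ c →
                (∀ v → v Sub.∈ negative c → Γ ⊢ᴴ unit v) → Γ ⊢ᴴ clause (positive c) Sub.⊥
resolve-units k {c} size≤k horn d units with Subₚ.nonempty? (negative c)
... | no empty = subst (_ ⊢ᴴ_) (cong (clause (positive c)) (Subₚ.Empty-unique empty)) d
... | yes (v , v∈) with k | ℕₚ.<-≤-trans (Subₚ.x∈p⇒∣p-x∣<∣p∣ v∈) size≤k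
...   | suc k′ | s≤s smaller = resolve-units k′ smaller horn
  (subst (_ ⊢ᴴ_) (resolvent-unit v c) (resolve v (units v v∈) d (isHorn-unit v) horn (Subₚ.x∈⁅x⁆ v) v∈))
  (λ w w∈ → units w (Subₚ.p─q⊆p _ _ w∈))

comprehension : ∀ {m} {P : Fin m → Set} → (∀ v → Dec (P v)) → Sub.Subset m
comprehension P? = Vec.tabulate (does ∘ P?)

does⁺ : ∀ {P : Set} (P? : Dec P) → P → does P? ≡ true
does⁺ (yes _) p = refl
does⁺ (no ¬p) p = contradiction p ¬p

does⁻ : ∀ {P : Set} (P? : Dec P) → does P? ≡ true → P
does⁻ (yes p) _ = p

∈-comprehension : ∀ {m} {P : Fin m → Set} (P? : ∀ v → Dec (P v)) v → v Sub.∈ comprehension P? ⇔ P v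
∈-comprehension P? v = mk⇔
  (λ v∈ → does⁻ (P? v) (trans (sym (Vecₚ.lookup∘tabulate _ v)) (Vecₚ.[]=⇒lookup v∈)))
  (λ p → Vecₚ.lookup⇒[]= v _ (trans (Vecₚ.lookup∘tabulate _ v) (does⁺ (P? v) p)))

singleton : ∀ {m} {p : Sub.Subset m} {x} → x Sub.∈ p → (∀ y → y Sub.∈ p → y ≡ x) → p ≡ Sub.⁅ x ⁆
singleton {x = x} x∈p unique = Subₚ.⊆-antisym
  (λ {y} y∈ → subst (Sub._∈ _) (sym (unique y y∈)) (Subₚ.x∈⁅x⁆ x))
  (λ y∈ → subst (Sub._∈ _) (sym (Subₚ.x∈⁅y⁆⇒x≡y x y∈)) x∈p)

-- Interpretations of Horn formulas

⌊⌋⇔ : ∀ {P : Set} (P? : Dec P) → T ⌊ P? ⌋ ⇔ P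
⌊⌋⇔ P? = mk⇔ (toWitness {a? = P?}) (fromWitness {a? = P?})

module _ {Cl Var : Set} where

  IsCl IsVar : Cl ⊎ Var → Set
  IsCl (inj₁ _) = ⊤
  IsCl (inj₂ _) = ⊥
  IsVar (inj₁ _) = ⊥
  IsVar (inj₂ _) = ⊤

  Occurs : (Cl → Var → Set) → Cl ⊎ Var → Cl ⊎ Var → Set
  Occurs R (inj₂ v) (inj₁ c) = R c v
  Occurs R _        _        = ⊥

  isCl? : ∀ i → Dec (IsCl i)
  isCl? (inj₁ _) = yes tt
  isCl? (inj₂ _) = no λ ()

  isVar? : ∀ i → Dec (IsVar i)
  isVar? (inj₁ _) = no λ ()
  isVar? (inj₂ _) = yes tt

  occurs? : ∀ {R} → (∀ c v → Dec (R c v)) → ∀ i j → Dec (Occurs R i j)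
  occurs? R? (inj₂ v) (inj₁ c) = R? c v
  occurs? R? (inj₂ v) (inj₂ w) = no λ ()
  occurs? R? (inj₁ c) _        = no λ ()

-- The interface between formulas and resolution: `decode` is the quotient map, and the argument
-- about Horn formulas uses nothing else of the interpretation.
record HornCoding {A : Set} (𝒟 : Defined A hornVoc) (Cl Var : Set) (Head Body : Cl → Var → Set) : Set where
  open Defined 𝒟
  field
    decode : Vec A d → Cl ⊎ Var
    decode-surjective : ∀ i → ∃ λ b → decode b ≡ i
    δ-all : ∀ b → δ b
    ε⇔ : ∀ b b′ → ε b b′ ⇔ decode b ≡ decode b′
    C⇔ : ∀ b → S symC (b ∷ []) ⇔ IsCl (decode b)
    V⇔ : ∀ b → S symV (b ∷ []) ⇔ IsVar (decode b)
    P⇔ : ∀ b b′ → S symP (b ∷ b′ ∷ []) ⇔ Occurs Head (decode b) (decode b′)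
    N⇔ : ∀ b b′ → S symN (b ∷ b′ ∷ []) ⇔ Occurs Body (decode b) (decode b′)

module _ {A : Set} {𝒟 : Defined A hornVoc} {Cl Var : Set} {Head Body : Cl → Var → Set}
         (coding : HornCoding 𝒟 Cl Var Head Body) where

  open Defined 𝒟
  open HornCoding coding

  module _ {ℭ : Structure hornVoc} (quotient : IsQuotient ℭ) {ψ : CNF} (enc : Encodes ℭ ψ) where

    open IsQuotient quotient
    open Encodes enc

    -- Membership in `HornRes` yields some quotient and some formula `ψ` encoded by it, with clauses
    -- and variables numbered arbitrarily. They are compared with the intended ones through common
    -- preimages in the interpreted universe.
    Match : Item ψ → Cl ⊎ Var → Set
    Match i j = ∃ λ b → Inverse.to items (π b) ≡ i × decode (proj₁ b) ≡ j

    match-item : ∀ i → ∃ (Match i)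
    match-item i =
      let b , πb≡ = surjective (Inverse.from items i) in
      _ , b , trans (cong (Inverse.to items) πb≡) (Inverse.strictlyInverseˡ items i) , refl

    match-coded : ∀ j → ∃ λ i → Match i j
    match-coded j = let b , e = decode-surjective j in _ , (b , δ-all b) , refl , e

    match-unique : ∀ {i j j′} → Match i j → Match i j′ → j ≡ j′
    match-unique (b , i≡ , refl) (b′ , i≡′ , refl) =
      to (ε⇔ _ _) (to (kernel b b′) (trans (sym (Inverse.strictlyInverseʳ items (π b)))
        (trans (cong (Inverse.from items) (trans i≡ (sym i≡′))) (Inverse.strictlyInverseʳ items (π b′)))))

    match-C : ∀ {i j} → Match i j → isClause ψ i ⇔ IsCl j
    match-C (b , refl , refl) = C⇔ (proj₁ b) ⇔-∘ (relations symC (b ∷ []) ⇔-∘ ⇔-sym (encC (π b)))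

    match-V : ∀ {i j} → Match i j → isVariable ψ i ⇔ IsVar j
    match-V (b , refl , refl) = V⇔ (proj₁ b) ⇔-∘ (relations symV (b ∷ []) ⇔-∘ ⇔-sym (encV (π b)))

    match-P : ∀ {i j i′ j′} → Match i j → Match i′ j′ → occursPos ψ i i′ ⇔ Occurs Head j j′
    match-P (b , refl , refl) (b′ , refl , refl) =
      P⇔ _ _ ⇔-∘ (relations symP (b ∷ b′ ∷ []) ⇔-∘ ⇔-sym (encP (π b) (π b′)))

    match-N : ∀ {i j i′ j′} → Match i j → Match i′ j′ → occursNeg ψ i i′ ⇔ Occurs Body j j′
    match-N (b , refl , refl) (b′ , refl , refl) =
      N⇔ _ _ ⇔-∘ (relations symN (b ∷ b′ ∷ []) ⇔-∘ ⇔-sym (encN (π b) (π b′)))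

    match-clause : ∀ i → ∃ λ c → Match (inj₁ i) (inj₁ c)
    match-clause i with match-item (inj₁ i)
    ... | inj₁ c , m = c , m
    ... | inj₂ w , m = ⊥-elim (to (match-C m) tt)

    match-variable : ∀ w → ∃ λ v → Match (inj₂ v) (inj₂ w)
    match-variable w with match-coded (inj₂ w)
    ... | inj₂ v , m = v , m
    ... | inj₁ i , m = ⊥-elim (from (match-V m) tt)

    module _ (M : Var → Set) (G : Set)
             (sat : ∀ c → (∀ v → Body c v → M v) → (∃ λ v → Head c v × M v) ⊎ G) where

      True : Fin (#vars ψ) → Set
      True v = ∃ λ w → Match (inj₂ v) (inj₂ w) × M w

      satisfied : ∀ i → Satisfied True G (List.lookup (clauses ψ) i)
      satisfied i neg-true with match-clause i
      ... | c , mc = Sum.map₁ head-true (sat c body-true)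
        where
        body-true : ∀ w → Body c w → M w
        body-true w bw with match-variable w
        ... | v , mv with neg-true v (from (match-N mv mc) bw)
        ...   | w′ , mv′ , Mw′ with match-unique mv mv′
        ...     | refl = Mw′
        head-true : (∃ λ w → Head c w × M w) →
                    ∃ λ v → v Sub.∈ positive (List.lookup (clauses ψ) i) × True v
        head-true (w , hw , Mw) = let v , mv = match-variable w in
          v , from (match-P mv mc) hw , w , mv , Mw

      refutation-sound : clauses ψ ⊢ᴴ □ → G
      refutation-sound ⊢□
        with resolution-sound True G
               (λ c∈ → subst (Satisfied True G) (sym (Anyₚ.lookup-index c∈)) (satisfied (Any.index c∈)))
               ⊢□ (λ v v∈⊥ → contradiction v∈⊥ Subₚ.∉⊥)
      ... | inj₁ (v , v∈⊥ , _) = contradiction v∈⊥ Subₚ.∉⊥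
      ... | inj₂ g = g

  hornRes-sound : QuotientIn HornRes → (M : Var → Set) (G : Set) →
                  (∀ c → (∀ v → Body c v → M v) → (∃ λ v → Head c v × M v) ⊎ G) → G
  hornRes-sound (_ , ℭ , quotient , ψ , enc , _ , ⊢□) M G sat = refutation-sound quotient enc M G sat ⊢□

  module HornFormula {nC nV : ℕ} (Cl↔ : Fin nC ↔ Cl) (Var↔ : Fin nV ↔ Var)
                     (head? : ∀ c v → Dec (Head c v)) (body? : ∀ c v → Dec (Body c v))
                     (head-unique : ∀ c v w → Head c v → Head c w → v ≡ w) where

    clauseOf : Cl → Clause nV
    clauseOf c = clause (comprehension λ v → head? c (Inverse.to Var↔ v))
                        (comprehension λ v → body? c (Inverse.to Var↔ v))

    ∈-positive : ∀ c v → v Sub.∈ positive (clauseOf c) ⇔ Head c (Inverse.to Var↔ v)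
    ∈-positive c = ∈-comprehension λ v → head? c (Inverse.to Var↔ v)

    ∈-negative : ∀ c v → v Sub.∈ negative (clauseOf c) ⇔ Body c (Inverse.to Var↔ v)
    ∈-negative c = ∈-comprehension λ v → body? c (Inverse.to Var↔ v)

    ψ : CNF
    ψ = record { #vars = nV ; clauses = List.tabulate (clauseOf ∘ Inverse.to Cl↔) }

    length≡ : length (clauses ψ) ≡ nC
    length≡ = Listₚ.length-tabulate _

    lookup-clause : ∀ i → List.lookup (clauses ψ) (cast (sym length≡) i) ≡ clauseOf (Inverse.to Cl↔ i)
    lookup-clause = Listₚ.lookup-tabulate _

    clause∈ : ∀ c → clauseOf c ∈ clauses ψ
    clause∈ c = subst (λ c → clauseOf c ∈ clauses ψ) (Inverse.strictlyInverseˡ Cl↔ c)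
      (Memₚ.∈-tabulate⁺ (Inverse.from Cl↔ c))

    horn : ∀ c → IsHornClause (clauseOf c)
    horn c with Subₚ.nonempty? (positive (clauseOf c))
    ... | no empty = ℕₚ.≤-trans (ℕₚ.≤-reflexive (trans (cong Sub.∣_∣ (Subₚ.Empty-unique empty)) (Subₚ.∣⊥∣≡0 nV))) z≤n
    ... | yes (v , v∈) = ℕₚ.≤-reflexive (trans (cong Sub.∣_∣ (singleton v∈ λ w w∈ →
        Injection.injective (↔⇒↣ Var↔) (head-unique c _ _ (to (∈-positive c w) w∈) (to (∈-positive c v) v∈))))
        (Subₚ.∣⁅x⁆∣≡1 v))

    isHorn : IsHorn ψ
    isHorn = Allₚ.tabulate⁺ (horn ∘ Inverse.to Cl↔)

    Derivable : Var → Set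
    Derivable v = clauses ψ ⊢ᴴ unit (Inverse.from Var↔ v)

    body-derivable : ∀ c → (∀ w → Body c w → Derivable w) → clauses ψ ⊢ᴴ clause (positive (clauseOf c)) Sub.⊥
    body-derivable c units = resolve-units _ ℕₚ.≤-refl (horn c) (axiom (clause∈ c)) λ v v∈ →
      subst (λ v → clauses ψ ⊢ᴴ unit v) (Inverse.strictlyInverseʳ Var↔ v)
        (units _ (to (∈-negative c v) v∈))

    derivable-closed : ∀ c v → Head c v → (∀ w → Body c w → Derivable w) → Derivable v
    derivable-closed c v hv units = subst (λ p → clauses ψ ⊢ᴴ clause p Sub.⊥)
      (singleton (from (∈-positive c _) (subst (Head c) (sym (Inverse.strictlyInverseˡ Var↔ v)) hv))
        λ w w∈ → trans (sym (Inverse.strictlyInverseʳ Var↔ w))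
          (cong (Inverse.from Var↔) (head-unique c _ _ (to (∈-positive c w) w∈) hv)))
      (body-derivable c units)

    refutable : ∀ c → (∀ v → ¬ Head c v) → (∀ w → Body c w → Derivable w) → clauses ψ ⊢ᴴ □
    refutable c headless units = subst (λ p → clauses ψ ⊢ᴴ clause p Sub.⊥)
      (Subₚ.Empty-unique λ { (v , v∈) → headless _ (to (∈-positive c v) v∈) }) (body-derivable c units)

    item : Fin (nC + nV) ↔ (Cl ⊎ Var)
    item = (Cl↔ ⊎-↔ Var↔) ↔-∘ +↔⊎

    module _ (nonEmptyℭ : NonZero (nC + nV)) where

      ℭ : Structure hornVoc
      size ℭ = nC + nV
      nonEmpty ℭ = nonEmptyℭ
      rel ℭ symC (x ∷ []) = ⌊ isCl? (Inverse.to item x) ⌋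
      rel ℭ symV (x ∷ []) = ⌊ isVar? (Inverse.to item x) ⌋
      rel ℭ symP (x ∷ y ∷ []) = ⌊ occurs? head? (Inverse.to item x) (Inverse.to item y) ⌋
      rel ℭ symN (x ∷ y ∷ []) = ⌊ occurs? body? (Inverse.to item x) (Inverse.to item y) ⌋

      isCongruence : IsCongruence
      isCongruence = record
        { isEquivalence = record
          { refl = from (ε⇔ _ _) refl
          ; sym = λ e → from (ε⇔ _ _) (sym (to (ε⇔ _ _) e))
          ; trans = λ e e′ → from (ε⇔ _ _) (trans (to (ε⇔ _ _) e) (to (ε⇔ _ _) e′))
          }
        ; compatible = λ where
          symC (e ∷ []) → from (C⇔ _) ∘ subst IsCl (to (ε⇔ _ _) e) ∘ to (C⇔ _)
          symV (e ∷ []) → from (V⇔ _) ∘ subst IsVar (to (ε⇔ _ _) e) ∘ to (V⇔ _)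
          symP (e ∷ e′ ∷ []) → from (P⇔ _ _) ∘ subst id (cong₂ (Occurs Head) (to (ε⇔ _ _) e) (to (ε⇔ _ _) e′)) ∘ to (P⇔ _ _)
          symN (e ∷ e′ ∷ []) → from (N⇔ _ _) ∘ subst id (cong₂ (Occurs Body) (to (ε⇔ _ _) e) (to (ε⇔ _ _) e′)) ∘ to (N⇔ _ _)
        }

      decoded : Vec A d → Cl ⊎ Var
      decoded b = Inverse.to item (Inverse.from item (decode b))

      item-from : ∀ b → decoded b ≡ decode b
      item-from b = Inverse.strictlyInverseˡ item (decode b)

      isQuotient : IsQuotient ℭ
      isQuotient = record
        { π = Inverse.from item ∘ decode ∘ proj₁
        ; surjective = λ x → let b , e = decode-surjective (Inverse.to item x) in
            (b , δ-all b) , trans (cong (Inverse.from item) e) (Inverse.strictlyInverseʳ item x)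
        ; kernel = λ { (b , _) (b′ , _) → mk⇔
            (λ e → from (ε⇔ _ _) (trans (sym (item-from b)) (trans (cong (Inverse.to item) e) (item-from b′))))
            (λ e → cong (Inverse.from item) (to (ε⇔ _ _) e)) }
        ; relations = λ where
          symC ((b , _) ∷ []) → ⇔-sym (C⇔ b) ⇔-∘ (≡⇒⇔ (cong IsCl (item-from b)) ⇔-∘ ⌊⌋⇔ (isCl? _))
          symV ((b , _) ∷ []) → ⇔-sym (V⇔ b) ⇔-∘ (≡⇒⇔ (cong IsVar (item-from b)) ⇔-∘ ⌊⌋⇔ (isVar? _))
          symP ((b , _) ∷ (b′ , _) ∷ []) → ⇔-sym (P⇔ b b′) ⇔-∘
            (≡⇒⇔ (cong₂ (Occurs Head) (item-from b) (item-from b′)) ⇔-∘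
             ⌊⌋⇔ (occurs? head? (decoded b) (decoded b′)))
          symN ((b , _) ∷ (b′ , _) ∷ []) → ⇔-sym (N⇔ b b′) ⇔-∘
            (≡⇒⇔ (cong₂ (Occurs Body) (item-from b) (item-from b′)) ⇔-∘
             ⌊⌋⇔ (occurs? body? (decoded b) (decoded b′)))
        }

      casts : Fin nC ↔ Fin (length (clauses ψ))
      casts = mk↔ₛ′ (cast (sym length≡)) (cast length≡)
                    (Finₚ.cast-involutive (sym length≡) length≡) (Finₚ.cast-involutive length≡ (sym length≡))

      coded : Fin nC ⊎ Fin nV → Cl ⊎ Var
      coded = Sum.map (Inverse.to Cl↔) (Inverse.to Var↔)

      numbered : Fin nC ⊎ Fin nV → Item ψ
      numbered = Sum.map (cast (sym length≡)) id

      coded-C : ∀ i → IsCl (coded i) ⇔ isClause ψ (numbered i)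
      coded-C (inj₁ c) = ⇔-id _
      coded-C (inj₂ v) = ⇔-id _

      coded-V : ∀ i → IsVar (coded i) ⇔ isVariable ψ (numbered i)
      coded-V (inj₁ c) = ⇔-id _
      coded-V (inj₂ v) = ⇔-id _

      coded-P : ∀ i j → Occurs Head (coded i) (coded j) ⇔ occursPos ψ (numbered i) (numbered j)
      coded-P (inj₁ c) j        = ⇔-id _
      coded-P (inj₂ v) (inj₂ w) = ⇔-id _
      coded-P (inj₂ v) (inj₁ c) = subst (λ d → _ ⇔ v Sub.∈ positive d) (sym (lookup-clause c))
        (⇔-sym (∈-positive (Inverse.to Cl↔ c) v))

      coded-N : ∀ i j → Occurs Body (coded i) (coded j) ⇔ occursNeg ψ (numbered i) (numbered j)
      coded-N (inj₁ c) j        = ⇔-id _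
      coded-N (inj₂ v) (inj₂ w) = ⇔-id _
      coded-N (inj₂ v) (inj₁ c) = subst (λ d → _ ⇔ v Sub.∈ negative d) (sym (lookup-clause c))
        (⇔-sym (∈-negative (Inverse.to Cl↔ c) v))

      encodes : Encodes ℭ ψ
      encodes = record
        { items = (casts ⊎-↔ ↔-id _) ↔-∘ +↔⊎
        ; encC = λ x → coded-C (Inverse.to +↔⊎ x) ⇔-∘ ⌊⌋⇔ (isCl? _)
        ; encV = λ x → coded-V (Inverse.to +↔⊎ x) ⇔-∘ ⌊⌋⇔ (isVar? _)
        ; encP = λ x y → coded-P (Inverse.to +↔⊎ x) (Inverse.to +↔⊎ y) ⇔-∘
            ⌊⌋⇔ (occurs? head? (Inverse.to item x) (Inverse.to item y))
        ; encN = λ x y → coded-N (Inverse.to +↔⊎ x) (Inverse.to +↔⊎ y) ⇔-∘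
            ⌊⌋⇔ (occurs? body? (Inverse.to item x) (Inverse.to item y))
        }

    hornRes-complete : ∀ c → (∀ v → ¬ Head c v) → (∀ w → Body c w → Derivable w) → QuotientIn HornRes
    hornRes-complete c headless units =
      isCongruence ne , ℭ ne , isQuotient ne , ψ , encodes ne , isHorn , refutable c headless units
      where
      ne : NonZero (nC + nV)
      ne = Finₚ.nonZeroIndex (Inverse.from item (inj₁ c))

-- Decoding tuples as nodes

Node : Code → ℕ → Set
Node c n = Σ[ s ∈ Shape ] (Tag c s × Tuple s n)

leftᴺ : ∀ {s c d n} → Node c n → Node (node s c d) n
leftᴺ (s , t , x) = s , left t , x

rightᴺ : ∀ {s c d n} → Node d n → Node (node s c d) n
rightᴺ (s , t , x) = s , right t , x

-- Two bits select among `this pos`, `this neg`, `left` and `right`. All nodes share one dimension,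
-- so room is reserved for every branch, and tuples that differ only in unread places are identified
-- by the congruence.
codeShape : Code → Shape
codeShape ∅            = vec 0
codeShape (node s c d) = vec 2 ⊗ vec 2 ⊗ s ⊗ codeShape c ⊗ codeShape d

bit : ∀ {n} → Vec (Fin n) 2 → Bool
bit (f ∷ g ∷ []) = does (f ≟ g)

select-node : ∀ {s c d n} → Bool → Bool → Tuple s n → Maybe (Node c n) → Maybe (Node d n) →
              Maybe (Node (node s c d) n)
select-node true  true  x u v = just (_ , this pos , x)
select-node true  false x u v = just (_ , this neg , x)
select-node false true  x u v = Maybe.map leftᴺ u
select-node false false x u v = Maybe.map rightᴺ v

decodeNode : ∀ c {n} → Tuple (codeShape c) n → Maybe (Node c n)
decodeNode ∅ _ = nothing
decodeNode (node s c d) (b , b′ , x , u , v) =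
  select-node (bit b) (bit b′) x (decodeNode c u) (decodeNode d v)

bit-true : ∀ {n} (x : Fin n) → bit (x ∷ x ∷ []) ≡ true
bit-true x = does⁺ (x ≟ x) refl

bit-false : ∀ {n} {x y : Fin n} → x ≢ y → bit (x ∷ y ∷ []) ≡ false
bit-false {x = x} {y} x≢y with x ≟ y
... | yes e = contradiction e x≢y
... | no _  = refl

bit-surjective : ∀ {n} {x y : Fin n} → x ≢ y → ∀ b → ∃ λ (v : Vec (Fin n) 2) → bit v ≡ b
bit-surjective {x = x} x≢y true  = x ∷ x ∷ [] , bit-true x
bit-surjective {x = x} {y} x≢y false = x ∷ y ∷ [] , bit-false x≢y

decodeNode-surjective : ∀ c {n} {x₀ x₁ : Fin n} → x₀ ≢ x₁ → (v : Node c n) →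
                        ∃ λ u → decodeNode c u ≡ just v
decodeNode-surjective (node s c d) {n} {x₀} {x₁} x₀≢x₁ = go
  where
  encode : ∀ b b′ x u v → ∃ λ y → decodeNode (node s c d) {n} y ≡ select-node b b′ x (decodeNode c u) (decodeNode d v)
  encode b b′ x u v =
    let w , e = bit-surjective x₀≢x₁ b ; w′ , e′ = bit-surjective x₀≢x₁ b′ in
    (w , w′ , x , u , v) , cong₂ (λ b b′ → select-node b b′ x (decodeNode c u) (decodeNode d v)) e e′
  go : (v : Node (node s c d) n) → ∃ λ u → decodeNode (node s c d) u ≡ just v
  go (_ , this pos , x) = encode true true x (inhabitant _ x₀) (inhabitant _ x₀)
  go (_ , this neg , x) = encode true false x (inhabitant _ x₀) (inhabitant _ x₀)
  go (_ , left t , x) =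
    let u , e = decodeNode-surjective c x₀≢x₁ (_ , t , x)
        y , e′ = encode false true (inhabitant _ x₀) u (inhabitant _ x₀) in
    y , trans e′ (cong (Maybe.map leftᴺ) e)
  go (_ , right t , x) =
    let v , e = decodeNode-surjective d x₀≢x₁ (_ , t , x)
        y , e′ = encode false false (inhabitant _ x₀) (inhabitant _ x₀) v in
    y , trans e′ (cong (Maybe.map rightᴺ) e)

-- Turning right at every level ends in `∅`. Such a tuple provides a preimage of the headless
-- clause.
decodeNode-nothing : ∀ c {n} {x₀ x₁ : Fin n} → x₀ ≢ x₁ → ∃ λ u → decodeNode c {n} u ≡ nothing
decodeNode-nothing ∅ _ = [] , refl
decodeNode-nothing (node s c d) {x₀ = x₀} {x₁} x₀≢x₁ =
  let v , e = decodeNode-nothing d x₀≢x₁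
      w , e′ = bit-surjective x₀≢x₁ false
      u = inhabitant (codeShape c) x₀ in
  (w , w , inhabitant s x₀ , u , v) ,
  trans (cong (λ b → select-node b b (inhabitant s x₀) (decodeNode c u) (decodeNode d v)) e′)
        (cong (Maybe.map rightᴺ) e)

Clauses : Code → ℕ → Set
Clauses c n = Maybe (Node c n × Node c n)

-- The universe formula admits every tuple, so undecodable ones must denote an item as well. They
-- are sent to `nothing`, the headless clause that queries the root.
toItem : ∀ {c n} → Bool → Maybe (Node c n) → Maybe (Node c n) → Clauses c n ⊎ Node c n
toItem true  (just v) _        = inj₂ v
toItem false (just v) (just w) = inj₁ (just (v , w))
toItem false (just v) nothing  = inj₁ nothing
toItem _     nothing  _        = inj₁ nothing

itemShape : Code → Shape
itemShape c = vec 2 ⊗ codeShape c ⊗ codeShape c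

decodeItem : ∀ c {n} → Tuple (itemShape c) n → Clauses c n ⊎ Node c n
decodeItem c (b , u , v) = toItem (bit b) (decodeNode c u) (decodeNode c v)

decodeItem-surjective : ∀ c {n} {x₀ x₁ : Fin n} → x₀ ≢ x₁ →
                        ∀ i → ∃ λ u → decodeItem c u ≡ i
decodeItem-surjective c {n} {x₀} x₀≢x₁ = go
  where
  encode : ∀ b u v → ∃ λ y → decodeItem c {n} y ≡ toItem b (decodeNode c u) (decodeNode c v)
  encode b u v = let w , e = bit-surjective x₀≢x₁ b in
    (w , u , v) , cong (λ b → toItem b (decodeNode c u) (decodeNode c v)) e
  go : ∀ i → ∃ λ u → decodeItem c {n} u ≡ i
  go (inj₂ v) =
    let u , e = decodeNode-surjective c x₀≢x₁ v
        y , e′ = encode true u u in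
    y , trans e′ (cong (λ p → toItem true p (decodeNode c u)) e)
  go (inj₁ (just (v , w))) =
    let u , e = decodeNode-surjective c x₀≢x₁ v
        u′ , f = decodeNode-surjective c x₀≢x₁ w
        y , e′ = encode false u u′ in
    y , trans e′ (cong₂ (toItem false) e f)
  go (inj₁ nothing) =
    let u , e = decodeNode-nothing c x₀≢x₁
        y , e′ = encode true u u in
    y , trans e′ (cong (λ p → toItem true p (decodeNode c u)) e)

if-⇔ : ∀ {P : Set} (P? : Dec P) (Q : Bool → Set) → ((P × Q true) ⊎ (¬ P × Q false)) ⇔ Q (does P?)
if-⇔ (yes p) Q = mk⇔ [ proj₂ , (λ { (¬p , _) → contradiction p ¬p }) ]′ (λ q → inj₁ (p , q))
if-⇔ (no ¬p) Q = mk⇔ [ (λ { (p , _) → contradiction p ¬p }) , proj₂ ]′ (λ q → inj₂ (¬p , q))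

-- First-order definability of decoding

PredicateOn : Vocabulary → (ℕ → Set) → ℕ → Set₁
PredicateOn σ X m = (𝔄 : Structure σ) → X (size 𝔄) → Vec (Element 𝔄) m → Set

module _ {σ : Vocabulary} {m : ℕ} where

  bitᵈ : (v : Vec (Fin m) 2) (R : PredicateOn σ (λ _ → Bool) m) →
         Definable (λ 𝔄 ρ → R 𝔄 true ρ) → Definable (λ 𝔄 ρ → R 𝔄 false ρ) →
         Definable λ 𝔄 ρ → R 𝔄 (bit (map (lookup ρ) v)) ρ
  bitᵈ (f ∷ g ∷ []) R D₁ D₂ =
    ⇔ᵈ (λ 𝔄 ρ → if-⇔ (lookup ρ f ≟ lookup ρ g) (λ b → R 𝔄 b ρ))
       ((≐ᵈ f g ×ᵈ D₁) ⊎ᵈ (¬ᵈ (≐ᵈ f g) ×ᵈ D₂))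

  -- Decoding is a finite case distinction whose tests are equalities of coordinates, so
  -- definability can be checked for each tag separately, with variables as arguments.
  nodeᵈ : ∀ c (v : Tuple (codeShape c) m) (R : PredicateOn σ (λ n → Maybe (Node c n)) m) →
          (∀ {s} (t : Tag c s) (x : Tuple s m) → Definable λ 𝔄 ρ → R 𝔄 (just (s , t , rename s (lookup ρ) x)) ρ) →
          Definable (λ 𝔄 ρ → R 𝔄 nothing ρ) →
          Definable λ 𝔄 ρ → R 𝔄 (decodeNode c (rename (codeShape c) (lookup ρ) v)) ρ
  nodeᵈ ∅ v R D D₀ = D₀
  nodeᵈ (node s c d) (b , b′ , x , u , v) R D D₀ =
    bitᵈ b (λ 𝔄 p ρ → R 𝔄 (select-node p (bit (map (lookup ρ) b′)) (rename s (lookup ρ) x) (dec-u 𝔄 ρ) (dec-v 𝔄 ρ)) ρ)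
      (bitᵈ b′ (λ 𝔄 p ρ → R 𝔄 (select-node true p (rename s (lookup ρ) x) (dec-u 𝔄 ρ) (dec-v 𝔄 ρ)) ρ)
        (D (this pos) x) (D (this neg) x))
      (bitᵈ b′ (λ 𝔄 p ρ → R 𝔄 (select-node false p (rename s (lookup ρ) x) (dec-u 𝔄 ρ) (dec-v 𝔄 ρ)) ρ)
        (nodeᵈ c u (λ 𝔄 p → R 𝔄 (Maybe.map leftᴺ p)) (λ t → D (left t)) D₀)
        (nodeᵈ d v (λ 𝔄 p → R 𝔄 (Maybe.map rightᴺ p)) (λ t → D (right t)) D₀))
    where
    dec-u : (𝔄 : Structure σ) → Vec (Element 𝔄) m → Maybe (Node c (size 𝔄))
    dec-u 𝔄 ρ = decodeNode c (rename (codeShape c) (lookup ρ) u)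
    dec-v : (𝔄 : Structure σ) → Vec (Element 𝔄) m → Maybe (Node d (size 𝔄))
    dec-v 𝔄 ρ = decodeNode d (rename (codeShape d) (lookup ρ) v)

  itemᵈ : ∀ c (v : Tuple (itemShape c) m) (R : PredicateOn σ (λ n → Clauses c n ⊎ Node c n) m) →
          (∀ {s} (t : Tag c s) (x : Tuple s m) → Definable λ 𝔄 ρ → R 𝔄 (inj₂ (s , t , rename s (lookup ρ) x)) ρ) →
          (∀ {s s′} (t : Tag c s) (t′ : Tag c s′) (x : Tuple s m) (x′ : Tuple s′ m) → Definable λ 𝔄 ρ →
             R 𝔄 (inj₁ (just ((s , t , rename s (lookup ρ) x) , (s′ , t′ , rename s′ (lookup ρ) x′)))) ρ) →
          Definable (λ 𝔄 ρ → R 𝔄 (inj₁ nothing) ρ) →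
          Definable λ 𝔄 ρ → R 𝔄 (decodeItem c (rename (itemShape c) (lookup ρ) v)) ρ
  itemᵈ c (b , u , v) R Dᵛ Dᶜ D₀ =
    bitᵈ b (λ 𝔄 p ρ → R 𝔄 (toItem p (dec 𝔄 ρ u) (dec 𝔄 ρ v)) ρ)
      (nodeᵈ c u (λ 𝔄 p ρ → R 𝔄 (toItem true p (dec 𝔄 ρ v)) ρ) Dᵛ D₀)
      (nodeᵈ c u (λ 𝔄 p ρ → R 𝔄 (toItem false p (dec 𝔄 ρ v)) ρ)
        (λ {s} t x → nodeᵈ c v (λ 𝔄 q ρ → R 𝔄 (toItem false (just (s , t , rename s (lookup ρ) x)) q) ρ)
          (λ t′ x′ → Dᶜ t t′ x x′) D₀)
        D₀)
    where
    dec : (𝔄 : Structure σ) → Vec (Element 𝔄) m → Tuple (codeShape c) m → Maybe (Node c (size 𝔄))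
    dec 𝔄 ρ v = decodeNode c (rename (codeShape c) (lookup ρ) v)

_≟ᵗ_ : ∀ {c} (p q : ∃ (Tag c)) → Dec (p ≡ q)
(_ , this s) ≟ᵗ (_ , this s′) = map′ (cong (λ s → _ , this s)) (λ { refl → refl }) (s Signₚ.≟ s′)
(_ , this _) ≟ᵗ (_ , left _)  = no λ ()
(_ , this _) ≟ᵗ (_ , right _) = no λ ()
(_ , left _) ≟ᵗ (_ , this _)  = no λ ()
(_ , left t) ≟ᵗ (_ , left t′) = map′ (cong (map₂ left)) (λ { refl → refl }) ((_ , t) ≟ᵗ (_ , t′))
(_ , left _) ≟ᵗ (_ , right _) = no λ ()
(_ , right _) ≟ᵗ (_ , this _) = no λ ()
(_ , right _) ≟ᵗ (_ , left _) = no λ ()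
(_ , right t) ≟ᵗ (_ , right t′) = map′ (cong (map₂ right)) (λ { refl → refl }) ((_ , t) ≟ᵗ (_ , t′))

node-injective : ∀ {c s n} {t : Tag c s} {x y : Tuple s n} →
                 _≡_ {A = Node c n} (s , t , x) (s , t , y) → x ≡ y
node-injective refl = refl

-- Agreement of the tags does not depend on the structure and is settled while the formula is built;
-- only the arguments are compared inside it.
node≡ᵈ : ∀ {σ c s s′ m} (t : Tag c s) (t′ : Tag c s′) (x : Tuple s m) (x′ : Tuple s′ m) →
         Definable {σ} λ 𝔄 ρ → _≡_ {A = Node c (size 𝔄)} (s , t , rename s (lookup ρ) x) (s′ , t′ , rename s′ (lookup ρ) x′)
node≡ᵈ {s = s} {s′} t t′ x x′ with (s , t) ≟ᵗ (s′ , t′)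
... | yes refl = ⇔ᵈ (λ 𝔄 ρ → mk⇔ (cong λ x → s , t , x) node-injective) (tuple≡ᵈ s x x′)
... | no t≢t′ = ⇔ᵈ (λ 𝔄 ρ → mk⇔ ⊥-elim λ e → t≢t′ (cong (map₂ proj₁) e)) ⊥ᵈ

-- Finiteness of the sets of nodes and clauses

Finite : Set → Set
Finite A = ∃ λ N → Fin N ↔ A

tuple-finite : ∀ s n → Finite (Tuple s n)
tuple-finite (vec zero) n = 1 , mk↔ₛ′ (λ _ → []) (λ _ → zero) (λ { [] → refl }) (λ { zero → refl })
tuple-finite (vec (suc k)) n = let N , e = tuple-finite (vec k) n in
  n * N , mk↔ₛ′ (λ { (x , xs) → x ∷ xs }) (λ { (x ∷ xs) → x , xs }) (λ { (x ∷ xs) → refl }) (λ { (x , xs) → refl })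
          ↔-∘ ((↔-id _ ×-↔ e) ↔-∘ *↔×)
tuple-finite (s ⊗ t) n = let M , e = tuple-finite s n ; N , e′ = tuple-finite t n in
  M * N , (e ×-↔ e′) ↔-∘ *↔×

node-finite : ∀ c n → Finite (Node c n)
node-finite ∅ n = 0 , mk↔ₛ′ (λ ()) (λ { (_ , () , _) }) (λ { (_ , () , _) }) (λ ())
node-finite (node s c d) n =
  let M , e = tuple-finite s n ; N , f = node-finite c n ; L , g = node-finite d n in
  (2 * M) + (N + L) , branches ↔-∘ ((((↔-id _ ×-↔ e) ↔-∘ *↔×) ⊎-↔ ((f ⊎-↔ g) ↔-∘ +↔⊎)) ↔-∘ +↔⊎)
  where
  branches : ((Fin 2 × Tuple s n) ⊎ (Node c n ⊎ Node d n)) ↔ Node (node s c d) n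
  branches = mk↔ₛ′
    (λ { (inj₁ (zero , x)) → s , this pos , x
       ; (inj₁ (suc zero , x)) → s , this neg , x
       ; (inj₂ (inj₁ v)) → leftᴺ v
       ; (inj₂ (inj₂ v)) → rightᴺ v })
    (λ { (_ , this pos , x) → inj₁ (zero , x)
       ; (_ , this neg , x) → inj₁ (suc zero , x)
       ; (_ , left t , x) → inj₂ (inj₁ (_ , t , x))
       ; (_ , right t , x) → inj₂ (inj₂ (_ , t , x)) })
    (λ { (_ , this pos , x) → refl ; (_ , this neg , x) → refl
       ; (_ , left t , x) → refl ; (_ , right t , x) → refl })
    (λ { (inj₁ (zero , x)) → refl ; (inj₁ (suc zero , x)) → refl
       ; (inj₂ (inj₁ v)) → refl ; (inj₂ (inj₂ v)) → refl })

clauses-finite : ∀ c n → Finite (Clauses c n)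
clauses-finite c n = let N , e = node-finite c n in
  1 + N * N , mk↔ₛ′ [ (λ _ → nothing) , just ]′ (λ { nothing → inj₁ zero ; (just p) → inj₂ p })
                    (λ { nothing → refl ; (just p) → refl }) (λ { (inj₁ zero) → refl ; (inj₂ p) → refl })
              ↔-∘ ((↔-id (Fin 1) ⊎-↔ ((e ×-↔ e) ↔-∘ *↔×)) ↔-∘ +↔⊎)

finite⇒≟ : ∀ {A : Set} → Finite A → (x y : A) → Dec (x ≡ y)
finite⇒≟ (N , e) x y =
  map′ (λ p → trans (sym (Inverse.strictlyInverseˡ e x))
              (trans (cong (Inverse.to e) p) (Inverse.strictlyInverseˡ e y)))
       (cong (Inverse.from e)) (Inverse.from e x ≟ Inverse.from e y)

-- Structures with a single element

∅ʳ : ∀ {n r} → Relation n r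
∅ʳ _ = false

-- On a structure with a single element, a least fixed point is already
-- reached after one step.
module _ {n : ℕ} (n≢0 : NonZero n) where

  open LFP-Semantics n≢0

  Collapsed : ∀ {σ k} (φ : LFP σ k) → Relations σ n → Vec (Fin n) k → Set
  Collapsed (atom R ts) A a   = T ((A at R) (map (lookup a) ts))
  Collapsed (s ≐ t) A a       = lookup a s ≡ lookup a t
  Collapsed (¬′ φ) A a        = ¬ Collapsed φ A a
  Collapsed (φ ∧′ ψ) A a      = Collapsed φ A a × Collapsed ψ A a
  Collapsed (φ ∨′ ψ) A a      = Collapsed φ A a ⊎ Collapsed ψ A a
  Collapsed (∃′ φ) A a        = ∃ λ x → Collapsed φ A (x ∷ a)
  Collapsed (∀′ φ) A a        = ∀ x → Collapsed φ A (x ∷ a)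
  Collapsed (lfp ψ p ts) A a  = Collapsed ψ (A ▹ ∅ʳ) (map (lookup a) ts ++ a)

  vec-unique : (∀ (x y : Fin n) → x ≡ y) → ∀ {r} (xs ys : Vec (Fin n) r) → xs ≡ ys
  vec-unique unique []       []       = refl
  vec-unique unique (x ∷ xs) (y ∷ ys) = cong₂ _∷_ (unique x y) (vec-unique unique xs ys)

  collapsed⇔ : (∀ (x y : Fin n) → x ≡ y) → ∀ {σ k} (φ : LFP σ k) A a →
               Collapsed φ A a ⇔ ⟨ A ⟩ ⊨ᴸ φ [ a ]
  collapsed⇔ unique (atom R ts) A a = ⇔-id _
  collapsed⇔ unique (s ≐ t) A a     = ⇔-id _
  collapsed⇔ unique (¬′ φ) A a      = ¬-cong-⇔ (collapsed⇔ unique φ A a)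
  collapsed⇔ unique (φ ∧′ ψ) A a    = collapsed⇔ unique φ A a ×-⇔ collapsed⇔ unique ψ A a
  collapsed⇔ unique (φ ∨′ ψ) A a    = collapsed⇔ unique φ A a ⊎-⇔ collapsed⇔ unique ψ A a
  collapsed⇔ unique (∃′ φ) A a      = ∃-cong-⇔ λ x → collapsed⇔ unique φ A (x ∷ a)
  collapsed⇔ unique (∀′ φ) A a      = ∀-cong-⇔ λ x → collapsed⇔ unique φ A (x ∷ a)
  collapsed⇔ unique (lfp ψ p ts) A a =
    ⇔-sym (lfp⇔stage xs) ⇔-∘ (mk⇔ (λ q → 1 , stage-suc⁺ 0 xs q) (λ { (i , q) → first i q })
      ⇔-∘ collapsed⇔ unique ψ (A ▹ ∅ʳ) (xs ++ a))
    where
    open LFP-Stages ψ p A a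
    xs = map (lookup a) ts
    first : ∀ i → T (stage i xs) → Operator ψ A a ∅ʳ xs
    first i q with (A ▹ ∅ʳ) ⊨? ψ [ xs ++ a ]
    ... | yes r = r
    -- There is only one tuple, so failure of the body there makes the empty relation prefixed, and
    -- then all stages are empty.
    ... | no ¬r = ⊥-elim (stage-⊆-prefixed {∅ʳ}
                    (λ ys r → ¬r (subst (Operator ψ A a ∅ʳ) (vec-unique unique ys xs) r)) i xs q)

-- `E` also interprets the fixed-point variables bound so far, each by the empty relation; the
-- induction maintains that everything in `E` is definable over the original structure.
collapsedᵈ : ∀ {σ σ′ k} (φ : LFP σ′ k) (E : (𝔄 : Structure σ) → Relations σ′ (size 𝔄)) →
             (∀ R {m} (ts : Vec (Fin m) (arity σ′ R)) → Definable λ 𝔄 ρ → T ((E 𝔄 at R) (map (lookup ρ) ts))) →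
             ∀ {m} (v : Vec (Fin m) k) →
             Definable λ 𝔄 ρ → Collapsed (nonEmpty 𝔄) φ (E 𝔄) (map (lookup ρ) v)
collapsedᵈ (atom R ts) E Eᵈ v =
  ⇔ᵈ (λ 𝔄 ρ → ≡⇒⇔ (cong (λ xs → T ((E 𝔄 at R) xs)) (map-lookup-map (lookup ρ) ts v))) (Eᵈ R (map (lookup v) ts))
collapsedᵈ (s ≐ t) E Eᵈ v =
  ⇔ᵈ (λ 𝔄 ρ → ≡⇒⇔ (sym (cong₂ _≡_ (Vecₚ.lookup-map s (lookup ρ) v) (Vecₚ.lookup-map t (lookup ρ) v))))
     (≐ᵈ (lookup v s) (lookup v t))
collapsedᵈ (¬′ φ) E Eᵈ v   = ¬ᵈ (collapsedᵈ φ E Eᵈ v)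
collapsedᵈ (φ ∧′ ψ) E Eᵈ v = collapsedᵈ φ E Eᵈ v ×ᵈ collapsedᵈ ψ E Eᵈ v
collapsedᵈ (φ ∨′ ψ) E Eᵈ v = collapsedᵈ φ E Eᵈ v ⊎ᵈ collapsedᵈ ψ E Eᵈ v
collapsedᵈ (∃′ φ) E Eᵈ v =
  ∃ᵈ {R = λ 𝔄 x ρ → Collapsed (nonEmpty 𝔄) φ (E 𝔄) (x ∷ map (lookup ρ) v)}
    (⇔ᵈ (λ { 𝔄 (x ∷ ρ) → ≡⇒⇔ (cong (λ xs → Collapsed (nonEmpty 𝔄) φ (E 𝔄) (x ∷ xs)) (sym (Vecₚ.map-∘ _ _ v))) })
        (collapsedᵈ φ E Eᵈ (zero ∷ map suc v)))
collapsedᵈ (∀′ φ) E Eᵈ v =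
  ∀ᵈ {R = λ 𝔄 x ρ → Collapsed (nonEmpty 𝔄) φ (E 𝔄) (x ∷ map (lookup ρ) v)}
    (⇔ᵈ (λ { 𝔄 (x ∷ ρ) → ≡⇒⇔ (cong (λ xs → Collapsed (nonEmpty 𝔄) φ (E 𝔄) (x ∷ xs)) (sym (Vecₚ.map-∘ _ _ v))) })
        (collapsedᵈ φ E Eᵈ (zero ∷ map suc v)))
collapsedᵈ {σ} {σ′} (lfp {r} ψ p ts) E Eᵈ v =
  ⇔ᵈ (λ 𝔄 ρ → ≡⇒⇔ (cong (Collapsed (nonEmpty 𝔄) ψ (E′ 𝔄))
        (trans (Vecₚ.map-++ (lookup ρ) (map (lookup v) ts) v)
               (cong (_++ map (lookup ρ) v) (map-lookup-map (lookup ρ) ts v)))))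
     (collapsedᵈ ψ E′ E′ᵈ (map (lookup v) ts ++ v))
  where
  E′ : (𝔄 : Structure σ) → Relations (r ∷ σ′) (size 𝔄)
  E′ 𝔄 = LFP-Semantics._▹_ (nonEmpty 𝔄) (E 𝔄) ∅ʳ
  E′ᵈ : ∀ R {m} (ts : Vec (Fin m) (arity (r ∷ σ′) R)) → Definable λ 𝔄 ρ → T ((E′ 𝔄 at R) (map (lookup ρ) ts))
  E′ᵈ zero    ts = ⊥ᵈ
  E′ᵈ (suc R) ts = Eᵈ R ts

-- The Horn formula of a system of rules

element : ∀ {n} → NonZero n → Fin n
element {suc n} _ = zero

Big : ∀ {σ} → Structure σ → Set
Big 𝔄 = ∃₂ λ (x y : Element 𝔄) → x ≢ y

big? : ∀ {σ} (𝔄 : Structure σ) → Dec (Big 𝔄)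
big? 𝔄 = any? λ x → any? λ y → ¬? (x ≟ y)

¬big⇒unique : ∀ {σ} (𝔄 : Structure σ) → ¬ Big 𝔄 → ∀ (x y : Element 𝔄) → x ≡ y
¬big⇒unique 𝔄 ¬big x y with x ≟ y
... | yes e = e
... | no x≢y = contradiction (x , y , x≢y) ¬big

bigᵈ : ∀ {σ m} → Definable {σ} {m} λ 𝔄 ρ → Big 𝔄
bigᵈ = ∃ᵈ {R = λ 𝔄 x _ → ∃ λ y → x ≢ y} (∃ᵈ {R = λ 𝔄 y ρ → Vec.head ρ ≢ y}
  (⇔ᵈ (λ { 𝔄 (y ∷ x ∷ ρ) → ⇔-id _ }) (¬ᵈ (≐ᵈ (suc zero) zero))))

HeadOf : ∀ {c n} → Clauses c n → Node c n → Set
HeadOf nothing        v = ⊥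
HeadOf (just (w , _)) v = v ≡ w

headOf-unique : ∀ {c n} (d : Clauses c n) v w → HeadOf d v → HeadOf d w → v ≡ w
headOf-unique (just (u , _)) v w refl refl = refl

module System {σ : Vocabulary} {k : ℕ} (c : Code) (rs : ∀ {s} → Tag c s → Rule σ (Tag c) s)
              (root : Tag c (vec k ⊗ vec 0)) where

  Edge : ∀ {n} → Node c n → Node c n → Set
  Edge (s , t , x) v = ∃₂ λ i z →
    v ≡ (_ , target (calls (rs t) i) , apply (args (calls (rs t) i)) z x)

  -- The clause (v , w) has head v.  Its body consists of all successors of v
  -- if the junctor of v is a conjunction, and of w if it is a disjunction;
  -- it is made a tautology when the guard of v fails or w is no successor.
  Blocked : Sign → ∀ {n} → Node c n → Node c n → Set
  Blocked pos v w = ⊥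
  Blocked neg v w = ¬ Edge v w

  Required : Sign → ∀ {n} → Node c n → Node c n → Node c n → Set
  Required pos v w u = Edge v u
  Required neg v w u = u ≡ w

  junctorOf : ∀ {n} → Node c n → Sign
  junctorOf (s , t , x) = junctor (rs t)

  GuardOf : (𝔄 : Structure σ) → Node c (size 𝔄) → Set
  GuardOf 𝔄 (s , t , x) = Passes (guard (rs t)) 𝔄 x

  Tautology : (𝔄 : Structure σ) → Node c (size 𝔄) → Node c (size 𝔄) → Set
  Tautology 𝔄 v w = ¬ GuardOf 𝔄 v ⊎ Blocked (junctorOf v) v w

  BodyOf : (𝔄 : Structure σ) → Vec (Element 𝔄) k → Clauses c (size 𝔄) → Node c (size 𝔄) → Set
  BodyOf 𝔄 a nothing        u = u ≡ (_ , root , a , [])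
  BodyOf 𝔄 a (just (v , w)) u = (Tautology 𝔄 v w × u ≡ v) ⊎ Required (junctorOf v) v w u

  module _ {m : ℕ} where

    edgeᵈ : ∀ {s s′} (t : Tag c s) (t′ : Tag c s′) (x : Tuple s m) (x′ : Tuple s′ m) →
            Definable {σ} λ 𝔄 ρ → Edge {size 𝔄} (s , t , rename s (lookup ρ) x) (s′ , t′ , rename s′ (lookup ρ) x′)
    edgeᵈ {s} {s′} t t′ x x′ = ∃Finᵈ _ λ i → let cl = calls (rs t) i in
      ∃Vecᵈ (#fresh cl) {s ⊗ s′}
        {λ 𝔄 z (x , x′) → _≡_ {A = Node c (size 𝔄)} (s′ , t′ , x′) (_ , target cl , apply (args cl) z x)}
        (λ z (x , x′) →
          ⇔ᵈ (λ 𝔄 ρ → ≡⇒⇔ (cong (λ y → _≡_ {A = Node c (size 𝔄)} _ (_ , target cl , y)) (natural (args cl) (lookup ρ) z x)))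
             (node≡ᵈ t′ (target cl) x′ (apply (args cl) z x)))
        (x , x′)

    bodyᵈ : ∀ {s s′ s″} (t : Tag c s) (t′ : Tag c s′) (t″ : Tag c s″) x x′ x″
            (f : ∀ 𝔄 → Vec (Element 𝔄) m → Vec (Element 𝔄) k) →
            Definable {σ} {m} λ 𝔄 ρ → BodyOf 𝔄 (f 𝔄 ρ)
              (just ((s , t , rename s (lookup ρ) x) , (s′ , t′ , rename s′ (lookup ρ) x′)))
              (s″ , t″ , rename s″ (lookup ρ) x″)
    bodyᵈ {s} {s′} {s″} t t′ t″ x x′ x″ f =
      ((¬ᵈ (passesᵈ (guard (rs t)) x) ⊎ᵈ blockedᵈ (junctor (rs t))) ×ᵈ node≡ᵈ t″ t x″ x) ⊎ᵈ requiredᵈ (junctor (rs t))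
      where
      blockedᵈ : ∀ j → Definable λ 𝔄 ρ → Blocked j {size 𝔄} (s , t , rename s (lookup ρ) x)
                   (s′ , t′ , rename s′ (lookup ρ) x′)
      blockedᵈ pos = ⊥ᵈ
      blockedᵈ neg = ¬ᵈ (edgeᵈ t t′ x x′)
      requiredᵈ : ∀ j → Definable λ 𝔄 ρ → Required j {size 𝔄} (s , t , rename s (lookup ρ) x)
                    (s′ , t′ , rename s′ (lookup ρ) x′) (s″ , t″ , rename s″ (lookup ρ) x″)
      requiredᵈ pos = edgeᵈ t t″ x x″
      requiredᵈ neg = node≡ᵈ t″ t′ x″ x′

    occursᵈ : (R : ∀ 𝔄 → Vec (Element 𝔄) k → Clauses c (size 𝔄) → Node c (size 𝔄) → Set) (a : Vec (Fin m) k) →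
              (∀ {s} (t : Tag c s) x → Definable {σ} λ 𝔄 ρ → R 𝔄 (map (lookup ρ) a) nothing (s , t , rename s (lookup ρ) x)) →
              (∀ {s s′ s″} (t : Tag c s) (t′ : Tag c s′) (t″ : Tag c s″) x x′ x″ →
                 Definable {σ} λ 𝔄 ρ → R 𝔄 (map (lookup ρ) a)
                   (just ((s , t , rename s (lookup ρ) x) , (s′ , t′ , rename s′ (lookup ρ) x′)))
                   (s″ , t″ , rename s″ (lookup ρ) x″)) →
              ∀ v w → Definable λ 𝔄 ρ → Occurs (R 𝔄 (map (lookup ρ) a))
                        (decodeItem c (rename (itemShape c) (lookup ρ) v))
                        (decodeItem c (rename (itemShape c) (lookup ρ) w))
    occursᵈ R a D₀ D v w =
      itemᵈ c v (λ 𝔄 i ρ → Occurs (R 𝔄 (map (lookup ρ) a)) i (decodeItem c (rename (itemShape c) (lookup ρ) w)))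
        (λ {s″} t″ x″ → itemᵈ c w (λ 𝔄 j ρ → Occurs (R 𝔄 (map (lookup ρ) a)) (inj₂ (s″ , t″ , rename s″ (lookup ρ) x″)) j)
          (λ _ _ → ⊥ᵈ) (λ t t′ x x′ → D t t′ t″ x x′ x″) (D₀ t″ x″))
        (λ _ _ _ _ → ⊥ᵈ) ⊥ᵈ

    item≡ᵈ : ∀ v w → Definable {σ} {m} λ 𝔄 ρ →
               decodeItem c (rename (itemShape c) (lookup ρ) v) ≡ decodeItem c (rename (itemShape c) (lookup ρ) w)
    item≡ᵈ v w =
      itemᵈ c v (λ 𝔄 i ρ → i ≡ decodeItem c (rename (itemShape c) (lookup ρ) w))
        (λ {s} t x → itemᵈ c w (λ 𝔄 j ρ → inj₂ (s , t , rename s (lookup ρ) x) ≡ j)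
          (λ t′ x′ → ⇔ᵈ (λ 𝔄 ρ → mk⇔ (cong inj₂) Sumₚ.inj₂-injective) (node≡ᵈ t t′ x x′))
          (λ _ _ _ _ → ⇔ᵈ (λ 𝔄 ρ → mk⇔ (λ ()) (λ ())) ⊥ᵈ) (⇔ᵈ (λ 𝔄 ρ → mk⇔ (λ ()) (λ ())) ⊥ᵈ))
        (λ {s} {s′} t t′ x x′ → itemᵈ c w
          (λ 𝔄 j ρ → inj₁ (just ((s , t , rename s (lookup ρ) x) , (s′ , t′ , rename s′ (lookup ρ) x′))) ≡ j)
          (λ _ _ → ⇔ᵈ (λ 𝔄 ρ → mk⇔ (λ ()) (λ ())) ⊥ᵈ)
          (λ u u′ y y′ → ⇔ᵈ (λ 𝔄 ρ → mk⇔ (λ { (p , q) → cong (inj₁ ∘ just) (cong₂ _,_ p q) })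
                                          (λ e → let e′ = Maybeₚ.just-injective (Sumₚ.inj₁-injective e) in
                                                 cong proj₁ e′ , cong proj₂ e′))
                            (node≡ᵈ t u x y ×ᵈ node≡ᵈ t′ u′ x′ y′))
          (⇔ᵈ (λ 𝔄 ρ → mk⇔ (λ ()) (λ ())) ⊥ᵈ))
        (itemᵈ c w (λ 𝔄 j ρ → inj₁ nothing ≡ j)
          (λ _ _ → ⇔ᵈ (λ 𝔄 ρ → mk⇔ (λ ()) (λ ())) ⊥ᵈ)
          (λ _ _ _ _ → ⇔ᵈ (λ 𝔄 ρ → mk⇔ (λ ()) (λ ())) ⊥ᵈ)
          (⇔ᵈ (λ 𝔄 ρ → mk⇔ (λ _ → refl) _) ⊤ᵈ))

cong₃ : ∀ {A B C : Set} {D : Set₁} (f : A → B → C → D) {x x′ y y′ z z′} →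
        x ≡ x′ → y ≡ y′ → z ≡ z′ → f x y z ≡ f x′ y′ z′
cong₃ f refl refl refl = refl

-- The interpretation and its correctness

module SystemInterpretation {σ : Vocabulary} {k : ℕ} (c : Code) (rs : ∀ {s} → Tag c s → Rule σ (Tag c) s)
    (root : Tag c (vec k ⊗ vec 0))
    (Small : (𝔄 : Structure σ) → Vec (Element 𝔄) k → Set)
    (smallᵈ : ∀ {m} (a : Vec (Fin m) k) → Definable λ 𝔄 ρ → Small 𝔄 (map (lookup ρ) a)) where

  open System c rs root

  dimension : ℕ
  dimension = width (itemShape c)

  decoding : ∀ {n} → Vec (Fin n) dimension → Clauses c n ⊎ Node c n
  decoding b = decodeItem c (unflatten (itemShape c) b)

  decoding-map : ∀ {m n} (ρ : Vec (Fin n) m) b →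
                 decodeItem c (rename (itemShape c) (lookup ρ) (unflatten (itemShape c) b)) ≡ decoding (map (lookup ρ) b)
  decoding-map ρ b = cong (decodeItem c) (rename-unflatten (itemShape c) (lookup ρ) b)

  -- With a single element all tuples coincide, so the formula consists of
  -- one item: the empty clause if Small holds, and a variable otherwise.
  C-relation V-relation : (𝔄 : Structure σ) → Vec (Element 𝔄) k → Vec (Element 𝔄) dimension → Set
  C-relation 𝔄 a b = (Big 𝔄 × IsCl (decoding b)) ⊎ (¬ Big 𝔄 × Small 𝔄 a)
  V-relation 𝔄 a b = (Big 𝔄 × IsVar (decoding b)) ⊎ (¬ Big 𝔄 × ¬ Small 𝔄 a)

  P-relation N-relation : (𝔄 : Structure σ) → Vec (Element 𝔄) k → (b b′ : Vec (Element 𝔄) dimension) → Set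
  P-relation 𝔄 a b b′ = Big 𝔄 × Occurs HeadOf (decoding b) (decoding b′)
  N-relation 𝔄 a b b′ = Big 𝔄 × Occurs (BodyOf 𝔄 a) (decoding b) (decoding b′)

  module _ {m : ℕ} (a : Vec (Fin m) k) (b : Vec (Fin m) dimension) where

    C-relationᵈ : Definable λ 𝔄 ρ → C-relation 𝔄 (map (lookup ρ) a) (map (lookup ρ) b)
    C-relationᵈ = (bigᵈ ×ᵈ ⇔ᵈ (λ 𝔄 ρ → ≡⇒⇔ (cong IsCl (decoding-map ρ b)))
        (itemᵈ c (unflatten (itemShape c) b) (λ 𝔄 i _ → IsCl i) (λ _ _ → ⊥ᵈ) (λ _ _ _ _ → ⊤ᵈ) ⊤ᵈ))
      ⊎ᵈ (¬ᵈ bigᵈ ×ᵈ smallᵈ a)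

    V-relationᵈ : Definable λ 𝔄 ρ → V-relation 𝔄 (map (lookup ρ) a) (map (lookup ρ) b)
    V-relationᵈ = (bigᵈ ×ᵈ ⇔ᵈ (λ 𝔄 ρ → ≡⇒⇔ (cong IsVar (decoding-map ρ b)))
        (itemᵈ c (unflatten (itemShape c) b) (λ 𝔄 i _ → IsVar i) (λ _ _ → ⊤ᵈ) (λ _ _ _ _ → ⊥ᵈ) ⊥ᵈ))
      ⊎ᵈ (¬ᵈ bigᵈ ×ᵈ ¬ᵈ (smallᵈ a))

    module _ (b′ : Vec (Fin m) dimension) where

      P-relationᵈ : Definable λ 𝔄 ρ → P-relation 𝔄 (map (lookup ρ) a) (map (lookup ρ) b) (map (lookup ρ) b′)
      P-relationᵈ = bigᵈ ×ᵈ ⇔ᵈ (λ 𝔄 ρ → ≡⇒⇔ (cong₂ (Occurs HeadOf) (decoding-map ρ b) (decoding-map ρ b′)))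
        (occursᵈ (λ _ _ → HeadOf) a (λ _ _ → ⊥ᵈ) (λ t t′ t″ x x′ x″ → node≡ᵈ t″ t x″ x)
          (unflatten (itemShape c) b) (unflatten (itemShape c) b′))

      N-relationᵈ : Definable λ 𝔄 ρ → N-relation 𝔄 (map (lookup ρ) a) (map (lookup ρ) b) (map (lookup ρ) b′)
      N-relationᵈ = bigᵈ ×ᵈ ⇔ᵈ (λ 𝔄 ρ → ≡⇒⇔ (cong₂ (Occurs (BodyOf 𝔄 (map (lookup ρ) a))) (decoding-map ρ b) (decoding-map ρ b′)))
        (occursᵈ BodyOf a (λ t x → node≡ᵈ t root x (a , []))
          (λ t t′ t″ x x′ x″ → bodyᵈ t t′ t″ x x′ x″ (λ 𝔄 ρ → map (lookup ρ) a))
          (unflatten (itemShape c) b) (unflatten (itemShape c) b′))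

  ≈-relationᵈ : ∀ {m} (b b′ : Vec (Fin m) dimension) →
                Definable {σ} λ 𝔄 ρ → decoding (map (lookup ρ) b) ≡ decoding (map (lookup ρ) b′)
  ≈-relationᵈ b b′ = ⇔ᵈ (λ 𝔄 ρ → ≡⇒⇔ (cong₂ _≡_ (decoding-map ρ b) (decoding-map ρ b′)))
    (item≡ᵈ (unflatten (itemShape c) b) (unflatten (itemShape c) b′))

  private
    d = dimension

  tuple : Vec (Fin d) d
  tuple = Vec.allFin d

  left-tuple right-tuple : Vec (Fin (d + (d + k))) d
  left-tuple = map (_↑ˡ (d + k)) tuple
  right-tuple = map (d ↑ʳ_) (map (_↑ˡ k) tuple)

  unary : Vec (Fin (1 * d + k)) d
  unary = map (_↑ˡ k) (map (_↑ˡ 0) tuple)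

  binary₁ binary₂ : Vec (Fin (2 * d + k)) d
  binary₁ = map (_↑ˡ k) (map (_↑ˡ (d + 0)) tuple)
  binary₂ = map (_↑ˡ k) (map (d ↑ʳ_) (map (_↑ˡ 0) tuple))

  parameters : ∀ r → Vec (Fin (r * d + k)) k
  parameters r = map (r * d ↑ʳ_) (Vec.allFin k)

  Relationˢ : (S : Symbol hornVoc) → Predicate σ (arity hornVoc S * d + k)
  Relationˢ symC 𝔄 ρ = C-relation 𝔄 (map (lookup ρ) (parameters 1)) (map (lookup ρ) unary)
  Relationˢ symV 𝔄 ρ = V-relation 𝔄 (map (lookup ρ) (parameters 1)) (map (lookup ρ) unary)
  Relationˢ symP 𝔄 ρ = P-relation 𝔄 (map (lookup ρ) (parameters 2)) (map (lookup ρ) binary₁) (map (lookup ρ) binary₂)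
  Relationˢ symN 𝔄 ρ = N-relation 𝔄 (map (lookup ρ) (parameters 2)) (map (lookup ρ) binary₁) (map (lookup ρ) binary₂)

  -- Unfolding these formulas makes conversion checking diverge in practice.
  abstract
    universeᵈ : Definable {σ} {d + k} λ 𝔄 ρ → ⊤
    universeᵈ = ⊤ᵈ

    congruenceᵈ : Definable {σ} {d + (d + k)} λ 𝔄 ρ →
                    decoding (map (lookup ρ) left-tuple) ≡ decoding (map (lookup ρ) right-tuple)
    congruenceᵈ = ≈-relationᵈ left-tuple right-tuple

    symbolᵈ : ∀ S → Definable (Relationˢ S)
    symbolᵈ symC = C-relationᵈ (parameters 1) unary
    symbolᵈ symV = V-relationᵈ (parameters 1) unary
    symbolᵈ symP = P-relationᵈ (parameters 2) binary₁ binary₂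
    symbolᵈ symN = N-relationᵈ (parameters 2) binary₁ binary₂

  J : Interpretation (FO-HornRes σ) hornVoc k
  J = interp d (formula universeᵈ) (formula congruenceᵈ) (λ S → formula (symbolᵈ S))

  J-firstOrder : IsFirstOrderInterpretation J
  J-firstOrder = record
    { foδ = firstOrder universeᵈ ; fo≈ = firstOrder congruenceᵈ ; foS = λ S → firstOrder (symbolᵈ S) }

  module _ (𝔄 : Structure σ) (a : Vec (Element 𝔄) k) where

    private
      n = size 𝔄

    𝒟 : Defined (Element 𝔄) hornVoc
    𝒟 = record
      { d = d
      ; δ = λ b → 𝔄 ⊨ᴴ formula universeᵈ [ b ++ a ]
      ; ε = λ b b′ → 𝔄 ⊨ᴴ formula congruenceᵈ [ b ++ (b′ ++ a) ]
      ; S = λ S bs → 𝔄 ⊨ᴴ formula (symbolᵈ S) [ concat bs ++ a ]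
      }

    open Defined 𝒟 using (S; ε; QuotientIn)

    tuple-value : ∀ {r} (b : Vec (Element 𝔄) d) (ys : Vec (Element 𝔄) r) →
                  map (lookup (b ++ ys)) (map (_↑ˡ r) tuple) ≡ b
    tuple-value b ys = trans (lookup-↑ˡ b ys tuple) (Vecₚ.map-lookup-allFin b)

    parameters-value : ∀ r (ys : Vec (Element 𝔄) (r * d)) → map (lookup (ys ++ a)) (parameters r) ≡ a
    parameters-value r ys = trans (lookup-↑ʳ ys a (Vec.allFin k)) (Vecₚ.map-lookup-allFin a)

    unary-value : ∀ b → map (lookup (concat (b ∷ []) ++ a)) unary ≡ b
    unary-value b = trans (lookup-↑ˡ (b ++ []) a (map (_↑ˡ 0) tuple)) (tuple-value b [])

    binary₁-value : ∀ b b′ → map (lookup (concat (b ∷ b′ ∷ []) ++ a)) binary₁ ≡ b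
    binary₁-value b b′ =
      trans (lookup-↑ˡ (b ++ b′ ++ []) a (map (_↑ˡ (d + 0)) tuple)) (tuple-value b (b′ ++ []))

    binary₂-value : ∀ b b′ → map (lookup (concat (b ∷ b′ ∷ []) ++ a)) binary₂ ≡ b′
    binary₂-value b b′ =
      trans (lookup-↑ˡ (b ++ b′ ++ []) a (map (d ↑ʳ_) (map (_↑ˡ 0) tuple)))
            (trans (lookup-↑ʳ b (b′ ++ []) (map (_↑ˡ 0) tuple)) (tuple-value b′ []))

    left-value : ∀ (b b′ : Vec (Element 𝔄) d) → map (lookup (b ++ (b′ ++ a))) left-tuple ≡ b
    left-value b b′ = tuple-value b (b′ ++ a)

    right-value : ∀ (b b′ : Vec (Element 𝔄) d) → map (lookup (b ++ (b′ ++ a))) right-tuple ≡ b′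
    right-value b b′ = trans (lookup-↑ʳ b (b′ ++ a) (map (_↑ˡ k) tuple)) (tuple-value b′ a)

    ε⇔decoding : ∀ b b′ → ε b b′ ⇔ (decoding b ≡ decoding b′)
    ε⇔decoding b b′ =
      ≡⇒⇔ (cong₂ _≡_ (cong decoding (left-value b b′)) (cong decoding (right-value b b′)))
      ⇔-∘ defines congruenceᵈ 𝔄 (b ++ (b′ ++ a))

    C⇔relation : ∀ b → S symC (b ∷ []) ⇔ C-relation 𝔄 a b
    C⇔relation b = ≡⇒⇔ (cong₂ (C-relation 𝔄) (parameters-value 1 (concat (b ∷ []))) (unary-value b))
      ⇔-∘ defines (symbolᵈ symC) 𝔄 (concat (b ∷ []) ++ a)

    V⇔relation : ∀ b → S symV (b ∷ []) ⇔ V-relation 𝔄 a b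
    V⇔relation b = ≡⇒⇔ (cong₂ (V-relation 𝔄) (parameters-value 1 (concat (b ∷ []))) (unary-value b))
      ⇔-∘ defines (symbolᵈ symV) 𝔄 (concat (b ∷ []) ++ a)

    P⇔relation : ∀ b b′ → S symP (b ∷ b′ ∷ []) ⇔ P-relation 𝔄 a b b′
    P⇔relation b b′ =
      ≡⇒⇔ (cong₃ (P-relation 𝔄) (parameters-value 2 (concat (b ∷ b′ ∷ []))) (binary₁-value b b′) (binary₂-value b b′))
      ⇔-∘ defines (symbolᵈ symP) 𝔄 (concat (b ∷ b′ ∷ []) ++ a)

    N⇔relation : ∀ b b′ → S symN (b ∷ b′ ∷ []) ⇔ N-relation 𝔄 a b b′
    N⇔relation b b′ =
      ≡⇒⇔ (cong₃ (N-relation 𝔄) (parameters-value 2 (concat (b ∷ b′ ∷ []))) (binary₁-value b b′) (binary₂-value b b′))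
      ⇔-∘ defines (symbolᵈ symN) 𝔄 (concat (b ∷ b′ ∷ []) ++ a)

    universal : ∀ b → 𝔄 ⊨ᴴ formula universeᵈ [ b ++ a ]
    universal b = from (defines universeᵈ 𝔄 (b ++ a)) tt

    occurs-⊥ : ∀ {Cl Var : Set} (i j : Cl ⊎ Var) → ¬ Occurs (λ _ _ → ⊥) i j
    occurs-⊥ (inj₂ v) (inj₁ c) ()
    occurs-⊥ (inj₂ v) (inj₂ w) ()
    occurs-⊥ (inj₁ c) _        ()

    small-coding : ¬ Big 𝔄 → ∀ {Cl Var : Set} (i₀ : Cl ⊎ Var) → (∀ i → i₀ ≡ i) →
                   Small 𝔄 a ⇔ IsCl i₀ → (¬ Small 𝔄 a) ⇔ IsVar i₀ →
                   HornCoding 𝒟 Cl Var (λ _ _ → ⊥) (λ _ _ → ⊥)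
    small-coding ¬big i₀ unique small⇔ ¬small⇔ = record
      { decode = λ _ → i₀
      ; decode-surjective = λ i → Vec.replicate d (element (nonEmpty 𝔄)) , unique i
      ; δ-all = universal
      ; ε⇔ = λ b b′ → mk⇔ (λ _ → refl)
          (λ _ → from (ε⇔decoding b b′) (cong decoding (vec-unique (nonEmpty 𝔄) (¬big⇒unique 𝔄 ¬big) b b′)))
      ; C⇔ = λ b → (small⇔ ⇔-∘ mk⇔ [ (λ { (big , _) → contradiction big ¬big }) , proj₂ ]′ (λ s → inj₂ (¬big , s)))
                   ⇔-∘ C⇔relation b
      ; V⇔ = λ b → (¬small⇔ ⇔-∘ mk⇔ [ (λ { (big , _) → contradiction big ¬big }) , proj₂ ]′ (λ s → inj₂ (¬big , s)))
                   ⇔-∘ V⇔relation b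
      ; P⇔ = λ b b′ → mk⇔ (λ p → contradiction (proj₁ (to (P⇔relation b b′) p)) ¬big)
                          (λ o → contradiction o (occurs-⊥ i₀ i₀))
      ; N⇔ = λ b b′ → mk⇔ (λ p → contradiction (proj₁ (to (N⇔relation b b′) p)) ¬big)
                          (λ o → contradiction o (occurs-⊥ i₀ i₀))
      }

    small-sound : ¬ Big 𝔄 → Dec (Small 𝔄 a) → QuotientIn HornRes → Small 𝔄 a
    small-sound ¬big (yes s) q = s
    -- With `Small` false the only item is a variable, and a formula without clauses has no
    -- refutation.
    small-sound ¬big (no ¬s) q = ⊥-elim (hornRes-sound
      (small-coding ¬big {⊥} {⊤} (inj₂ tt) (λ { (inj₂ tt) → refl }) (mk⇔ ¬s λ ()) (mk⇔ _ λ _ → ¬s))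
      q (λ _ → ⊤) ⊥ λ ())

    small-complete : ¬ Big 𝔄 → Small 𝔄 a → QuotientIn HornRes
    small-complete ¬big s = HornFormula.hornRes-complete
      (small-coding ¬big {⊤} {⊥} (inj₁ tt) (λ { (inj₁ tt) → refl }) (mk⇔ _ λ _ → s) (mk⇔ (λ ¬s → ¬s s) λ ()))
      1↔⊤ 0↔⊥ (λ _ ()) (λ _ ()) (λ _ ()) tt (λ ()) (λ ())

    coding : Big 𝔄 → HornCoding 𝒟 (Clauses c n) (Node c n) HeadOf (BodyOf 𝔄 a)
    coding big@(x₀ , x₁ , x₀≢x₁) = record
      { decode = decoding
      ; decode-surjective = λ i → let u , e = decodeItem-surjective c x₀≢x₁ i in
          flatten (itemShape c) u , trans (cong (decodeItem c) (unflatten-flatten (itemShape c) u)) e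
      ; δ-all = universal
      ; ε⇔ = ε⇔decoding
      ; C⇔ = λ b → mk⇔ [ proj₂ , (λ { (¬big , _) → contradiction big ¬big }) ]′ (λ p → inj₁ (big , p))
                   ⇔-∘ C⇔relation b
      ; V⇔ = λ b → mk⇔ [ proj₂ , (λ { (¬big , _) → contradiction big ¬big }) ]′ (λ p → inj₁ (big , p))
                   ⇔-∘ V⇔relation b
      ; P⇔ = λ b b′ → mk⇔ proj₂ (big ,_) ⇔-∘ P⇔relation b b′
      ; N⇔ = λ b b′ → mk⇔ proj₂ (big ,_) ⇔-∘ N⇔relation b b′
      }

    infix 4 _≟ᴺ_
    _≟ᴺ_ : (v w : Node c n) → Dec (v ≡ w)
    _≟ᴺ_ = finite⇒≟ (node-finite c n)

    edge? : ∀ v w → Dec (Edge {n} v w)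
    edge? v w = any? λ i → anyVec? λ z → w ≟ᴺ _

    -- Decided by evaluating the defining formula, with the elements themselves as variables and the
    -- identity as assignment.
    guard? : ∀ v → Dec (GuardOf 𝔄 v)
    guard? (s , t , x) = subst (λ x → Dec (Passes (guard (rs t)) 𝔄 x)) (rename-id s Vecₚ.lookup-allFin x)
      (definable? (passesᵈ (guard (rs t)) x) 𝔄 (Vec.allFin n))

    blocked? : ∀ j v w → Dec (Blocked j {n} v w)
    blocked? pos v w = no λ ()
    blocked? neg v w = ¬? (edge? v w)

    required? : ∀ j v w u → Dec (Required j {n} v w u)
    required? pos v w u = edge? v u
    required? neg v w u = u ≟ᴺ w

    bodyOf? : ∀ d u → Dec (BodyOf 𝔄 a d u)
    bodyOf? nothing u = u ≟ᴺ _
    bodyOf? (just (v , w)) u =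
      ((¬? (guard? v) ⊎-dec blocked? (junctorOf v) v w) ×-dec (u ≟ᴺ v)) ⊎-dec required? (junctorOf v) v w u

    headOf? : ∀ (d : Clauses c n) u → Dec (HeadOf d u)
    headOf? nothing u = no λ ()
    headOf? (just (v , _)) u = u ≟ᴺ v

    Closed : Valuation (Tag c) n → Set
    Closed K = ∀ {s} (t : Tag c s) x → Holds (rs t) 𝔄 K x → K t x

    -- With the goal itself as `G`, the query clause becomes an identity, and closedness of `M`
    -- satisfies the other clauses.
    big-sound : Big 𝔄 → QuotientIn HornRes → (M : Valuation (Tag c) n) → Closed M → M root (a , [])
    big-sound big q M closed = hornRes-sound (coding big) q Holdsᴺ (M root (a , [])) clauses-satisfied
      where
      Holdsᴺ : Node c n → Set
      Holdsᴺ (_ , t , x) = M t x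
      fires : ∀ {s} (t : Tag c s) x w j → (Blocked j (s , t , x) w → M t x) →
              (∀ u → Required j (s , t , x) w u → Holdsᴺ u) → M t x ⊎ Fires j (calls (rs t)) M x
      fires t x w pos blocked required = inj₂ λ i z → required _ (i , z , refl)
      fires t x w neg blocked required with edge? (_ , t , x) w
      ... | no ¬e = inj₁ (blocked ¬e)
      ... | yes (i , z , refl) = inj₂ (i , z , required w refl)
      clauses-satisfied : ∀ d → (∀ u → BodyOf 𝔄 a d u → Holdsᴺ u) → (∃ λ v → HeadOf d v × Holdsᴺ v) ⊎ M root (a , [])
      clauses-satisfied nothing body = inj₂ (body _ refl)
      clauses-satisfied (just (v@(s , t , x) , w)) body with guard? v
      ... | no ¬g = inj₁ (v , refl , body v (inj₁ (inj₁ ¬g , refl)))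
      ... | yes g = inj₁ (v , refl , [ id , (λ f → closed t x (g , f)) ]′
        (fires t x w (junctor (rs t)) (λ bl → body v (inj₁ (inj₂ bl , refl))) (λ u r → body u (inj₂ r))))

    -- Derivability of units is a closed valuation, so `least` yields the unit of the root, which
    -- refutes the query clause.
    big-complete : Big 𝔄 → (∀ (K : Valuation (Tag c) n) → Closed K → K root (a , [])) → QuotientIn HornRes
    big-complete big least =
      hornRes-complete nothing (λ _ ()) λ { _ refl → least K closed }
      where
      open HornFormula (coding big) (proj₂ (clauses-finite c n)) (proj₂ (node-finite c n))
                       headOf? bodyOf? headOf-unique
      K : Valuation (Tag c) n
      K t x = Derivable (_ , t , x)
      supported : ∀ {s} (t : Tag c s) x j → Fires j (calls (rs t)) K x →
                  ∃ λ w → ¬ Blocked j (s , t , x) w × (∀ u → Required j (s , t , x) w u → Derivable u)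
      -- For a conjunction every second component gives the same requirements; the node itself is
      -- taken.
      supported t x pos f = (_ , t , x) , (λ ()) , λ { _ (i , z , refl) → f i z }
      supported t x neg (i , z , p) = _ , (λ ¬e → ¬e (i , z , refl)) , λ { _ refl → p }
      closed : Closed K
      closed t x (g , f) = let w , ¬blocked , required = supported t x (junctor (rs t)) f in
        derivable-closed (just (_ , w)) _ refl λ where
          _ (inj₁ (inj₁ ¬g , _)) → contradiction g ¬g
          _ (inj₁ (inj₂ bl , _)) → contradiction bl ¬blocked
          u (inj₂ r) → required u r

    𝒬J⇔ : ∀ {P : Set} → Dec P → (¬ Big 𝔄 → Small 𝔄 a ⇔ P) →
          (M : Valuation (Tag c) n) → Closed M → (M root (a , []) → P) →
          (Big 𝔄 → P → ∀ (K : Valuation (Tag c) n) → Closed K → K root (a , [])) →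
          𝔄 ⊨ᴴ 𝒬 J [ a ] ⇔ P
    𝒬J⇔ P? small⇔P M closed M⇒P P⇒K with big? 𝔄
    ... | no ¬big = let e = small⇔P ¬big in
      mk⇔ (to e ∘ small-sound ¬big (map′ (from e) (to e) P?)) (small-complete ¬big ∘ from e)
    ... | yes big = mk⇔ (λ q → M⇒P (big-sound big q M closed)) (λ p → big-complete big (P⇒K big p))

  interpretation : (φ : LFP σ k) →
    (∀ 𝔄 a → Dec (𝔄 ⊨ᴸ φ [ a ])) →
    (∀ 𝔄 a → ¬ Big 𝔄 → Small 𝔄 a ⇔ 𝔄 ⊨ᴸ φ [ a ]) →
    (∀ 𝔄 a → Σ[ M ∈ Valuation (Tag c) (size 𝔄) ] (Closed 𝔄 a M × (M root (a , []) → 𝔄 ⊨ᴸ φ [ a ]))) →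
    (∀ 𝔄 a → Big 𝔄 → 𝔄 ⊨ᴸ φ [ a ] → ∀ (K : Valuation (Tag c) (size 𝔄)) → Closed 𝔄 a K → K root (a , [])) →
    Σ[ J ∈ Interpretation (FO-HornRes σ) hornVoc k ] (IsFirstOrderInterpretation J × (𝒬 J) IsEquivalentTo φ)
  interpretation φ φ? small⇔φ sound complete = J , J-firstOrder , λ 𝔄 a →
    let M , closed , M⇒φ = sound 𝔄 a in
    𝒬J⇔ 𝔄 a (φ? 𝔄 a) (small⇔φ 𝔄 a) M closed M⇒φ (complete 𝔄 a)

-- Fixed-point formulas as single Horn resolution queries

lfp-interpretation : ∀ {σ k} (φ : LFP σ k) → Σ[ J ∈ Interpretation (FO-HornRes σ) hornVoc k ]
                     (IsFirstOrderInterpretation J × (𝒬 J) IsEquivalentTo φ)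
lfp-interpretation {σ} {k} φ =
  SystemInterpretation.interpretation (code φ (vec 0)) (rules φ (vec 0) base id) (this pos)
    (λ 𝔄 → Collapsed (nonEmpty 𝔄) φ (structure 𝔄))
    (collapsedᵈ φ structure (λ R ts → atomᵈ R ts)) φ
    (λ 𝔄 a → LFP-Semantics._⊨?_[_] (nonEmpty 𝔄) (structure 𝔄) φ a)
    (λ 𝔄 a ¬big → collapsed⇔ (nonEmpty 𝔄) (¬big⇒unique 𝔄 ¬big) φ (structure 𝔄) a)
    sound
    (λ { 𝔄 a (_ , _ , x₀≢x₁) p K closed →
      Completeness.complete 𝔄 x₀≢x₁ φ (vec 0) base id K closed [] (structure 𝔄) (λ R s z q → q , λ ()) pos a p })
  where
  base : Scope σ (Tag (code φ (vec 0))) σ (vec 0)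
  base = baseScope {σ}

  structure : (𝔄 : Structure σ) → Relations σ (size 𝔄)
  structure 𝔄 = mkRelations (rel 𝔄)

  sound : ∀ 𝔄 a → Σ[ M ∈ Valuation (Tag (code φ (vec 0))) (size 𝔄) ]
    ((∀ {s} (t : Tag (code φ (vec 0)) s) x → Holds (rules φ (vec 0) base id t) 𝔄 M x → M t x) ×
     (M {vec k ⊗ vec 0} (this pos) (a , []) → 𝔄 ⊨ᴸ φ [ a ]))
  sound 𝔄 a = Meaning φ (vec 0) C
    , meaning-closed φ (vec 0) C base id (Meaning φ (vec 0) C) (λ _ _ p → p) base-sound
    , λ m → m (structure 𝔄) λ _ _ → ⇔-id _
    where
    open Soundness 𝔄
    C : Compatibility σ (vec 0)
    C _ B = ∀ R z → T (rel 𝔄 R z) ⇔ T ((B at R) z)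
    base-sound : ScopeSound base (Meaning φ (vec 0) C) C
    base-sound R s z h (q , _) B agree = signed-map s (agree R z) q

sum-zero : ∀ {n} (f : Fin n → ℕ) → (∀ i → f i ≡ 0) → Vec.sum (Vec.tabulate f) ≡ 0
sum-zero {zero}  f f≡0 = refl
sum-zero {suc n} f f≡0 = cong₂ _+_ (f≡0 zero) (sum-zero (f ∘ suc) (f≡0 ∘ suc))

#𝒬-firstOrder : ∀ {σ k} {J : Interpretation (FO-HornRes σ) hornVoc k} → IsFirstOrderInterpretation J → #𝒬 (𝒬 J) ≡ 1
#𝒬-firstOrder {J = interp _ φδ φ≈ φS} fo =
  cong suc (cong₂ _+_ (cong₂ _+_ foδ fo≈) (sum-zero (#𝒬 ∘ φS) foS))
  where open IsFirstOrderInterpretation fo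

single-quantifier : ∀ {σ k} (φ : LFP σ k) →
  Σ[ J ∈ Interpretation (FO-HornRes σ) hornVoc k ] (IsFirstOrderInterpretation J × (𝒬 J) IsEquivalentTo φ) →
  Σ[ χ ∈ FO-HornRes σ k ] (#𝒬 χ ≡ 1 × χ IsEquivalentTo φ)
single-quantifier φ (J , fo , equivalent) = 𝒬 J , #𝒬-firstOrder fo , equivalent

theorem3p2 : (σ : Vocabulary) (k : ℕ) (φ : LFP σ k) →
    (Σ[ J ∈ Interpretation (FO-HornRes σ) hornVoc k ] (IsFirstOrderInterpretation J × (𝒬 J) IsEquivalentTo φ))
    × (Σ[ χ ∈ FO-HornRes σ k ] (#𝒬 χ ≡ 1 × χ IsEquivalentTo φ))
theorem3p2 σ k φ = lfp-interpretation φ , single-quantifier φ (lfp-interpretation φ)
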